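{- Let $m\ge 0$, let $v$ be a derangement of order $m$, and let $n\ge m$. Then the map ${\bf\Phi}=\phi_1\circ\phi_2\circ\cdots\circ\phi_n$ defined below is a bijection of $\mathrm{Sh}(0^{n-m}v)$ onto itself, and for every $w\in\mathrm{Sh}(0^{n-m}v)$, $$\mathrm{RISE}\,w=\mathrm{RISE}^\bullet\,{\bf\Phi}(w).$$
   Context: Words have nonnegative integer letters. For a word $w=x_1\cdots x_n$: $\mathrm{RISE}\,w=\{i:1\le i\le n,\ x_i\le x_{i+1}\}$ with the convention $x_{n+1}=+\infty$ (so $n\in\mathrm{RISE}\,w$). $\mathrm{Pos}\,w$ is the subword of positive letters of $w$. For a word $v$ of positive integers of length $m\le n$, $\mathrm{Sh}(0^{n-m}v)$ is the set of words of length $n$ having exactly $n-m$ letters equal to $0$ and with $\mathrm{Pos}\,w=v$. A derangement of order $m$ is a word $y_1\cdots y_m$ that is a permutation of $1,2,\dots,m$ with $y_i\neq i$ for all $i$. Excedance: let $v$ be a derangement of order $m$ and $w=x_1\cdots x_n\in\mathrm{Sh}(0^{n-m}v)$. For each position $k$ with $x_k>0$, let $\mathrm{red}(k)$ be the number of positive letters among $x_1,\dots,x_k$. The positive letter $x_k$ is excedent if $x_k>\mathrm{red}(k)$ and subexcedent if $x_k<\mathrm{red}(k)$ (one of these always holds). A letter is non-subexcedent if it is $0$ or excedent. The fictitious letters $x_0=x_{n+1}=+\infty$ are regarded as excedent (hence non-subexcedent). $\mathrm{RISE}^\bullet w$ is the set of $i$, $1\le i\le n$, such that one of the following holds: (1)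 $0<x_i<x_{i+1}$; (2) $x_i=x_{i+1}=0$; (3) $x_i=0$ and $x_{i+1}$ is excedent; (4) $x_i$ is subexcedent and $x_{i+1}=0$. The maps $\phi_l$ ($1\le l\le n$) on $\mathrm{Sh}(0^{n-m}v)$: if $l>n-m$, $\phi_l(w)=w$. If $1\le l\le n-m$, let $j$ be the position of the $l$-th letter equal to $0$ in $w$, read from left to right. (a) If $x_{j-1}$ and $x_{j+1}$ are both non-subexcedent, $\phi_l(w)=w$. (b) If $x_{j-1}$ is non-subexcedent and $x_{j+1}$ is subexcedent, or if both are subexcedent with $x_{j-1}>x_{j+1}$: let $k$ be the greatest integer $k\ge j+1$ with $x_{j+1}<x_{j+2}<\cdots<x_k<\mathrm{red}(k)$, and set $\phi_l(w)=x_1\cdots x_{j-1}\,x_{j+1}\cdots x_k\,0\,x_{k+1}\cdots x_n$. (c) If $x_{j-1}$ is subexcedent and $x_{j+1}$ is non-subexcedent, or if both are subexcedent with $x_{j-1}<x_{j+1}$: let $i$ be the smallest integer $i\le j-1$ with $\mathrm{red}(i)>x_i>x_{i+1}>\cdots>x_{j-1}$, and set $\phi_l(w)=x_1\cdots x_{i-1}\,0\,x_i\cdots x_{j-1}\,x_{j+1}\cdots x_n$. Finally ${\bf\Phi}(w)=\phi_1(\phi_2(\cdots\phi_n(w)\cdots))$. -}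

module Defs where

open import Data.Bool.Base using (if_then_else_)
open import Data.List.Base
  using (List; []; _∷_; _++_; length; take; drop; filter; foldr; applyUpTo)
open import Data.List.Extrema.Nat using (max; min)
open import Data.List.Relation.Binary.Permutation.Propositional using (_↭_)
open import Data.Nat.Base using (ℕ; zero; suc; pred; _∸_; _≤_; _<_)
open import Data.Nat.Properties using (_≟_; _≤?_; _<?_; allUpTo?)
open import Data.Product.Base using (Σ; Σ-syntax; _×_; _,_; proj₁)
open import Data.Sum.Base using (_⊎_)
open import Function.Base using (_on_)
open import Function.Definitions using (Bijective)
open import Level using (0ℓ)
open import Relation.Binary.Construct.Add.Supremum.NonStrict _≤_ using (_≤⁺_)
open import Relation.Binary.Construct.Add.Supremum.Strict _<_ using (_<⁺_; <⁺-dec)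
open import Relation.Binary.Definitions using (Decidable)
open import Relation.Binary.PropositionalEquality.Core using (_≡_; _≢_)
open import Relation.Nullary.Construct.Add.Supremum using (_⁺; [_]; ⊤⁺; ≡-dec)
open import Relation.Nullary.Decidable.Core using (Dec; does; _×-dec_; _⊎-dec_; _→-dec_)
open import Relation.Unary using (Pred; _∈_)

Word : Set
Word = List ℕ

-- Positions are 1-based.  Position 0 and all positions beyond the length
-- carry the fictitious letter +∞, so x₀ = xₙ₊₁ = +∞.
letter : Word → ℕ → ℕ ⁺
letter w       zero          = ⊤⁺
letter []      (suc i)       = ⊤⁺
letter (x ∷ w) (suc zero)    = [ x ]
letter (x ∷ w) (suc (suc i)) = letter w (suc i)

positions : Word → List ℕ
positions w = applyUpTo suc (length w)

zeros : Word → Word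
zeros = filter (_≟ 0)

Pos : Word → Word
Pos = filter (0 <?_)

-- The shuffles Sh(0ⁿ⁻ᵐ v), where m is the length of v.
Sh : ℕ → Word → Pred Word 0ℓ
Sh n v w = length w ≡ n × length (zeros w) ≡ n ∸ length v × Pos w ≡ v

Derangement : ℕ → Pred Word 0ℓ
Derangement m v =
  v ↭ applyUpTo suc m × (∀ i → 1 ≤ i → i ≤ m → letter v i ≢ [ i ])

red : Word → ℕ → ℕ
red w k = length (Pos (take k w))

-- The fictitious letters satisfy Excedent and not Subexcedent.
Excedent Subexcedent NonSubexcedent : Word → Pred ℕ 0ℓ
Excedent       w k = [ 0 ] <⁺ letter w k × [ red w k ] <⁺ letter w k
Subexcedent    w k = [ 0 ] <⁺ letter w k × letter w k <⁺ [ red w k ]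
NonSubexcedent w k = letter w k ≡ [ 0 ] ⊎ Excedent w k

RISE : Word → Pred ℕ 0ℓ
RISE w i = (1 ≤ i × i ≤ length w) × letter w i ≤⁺ letter w (suc i)

RISE• : Word → Pred ℕ 0ℓ
RISE• w i = (1 ≤ i × i ≤ length w) ×
  ( ([ 0 ] <⁺ letter w i × letter w i <⁺ letter w (suc i))
  ⊎ (letter w i ≡ [ 0 ] × letter w (suc i) ≡ [ 0 ])
  ⊎ (letter w i ≡ [ 0 ] × Excedent w (suc i))
  ⊎ (Subexcedent w i × letter w (suc i) ≡ [ 0 ]))

-- Case (b): the 0 at position j moves to the right.
MovesRight : Word → Pred ℕ 0ℓ
MovesRight w j =
  (NonSubexcedent w (pred j) × Subexcedent w (suc j)) ⊎
  ((Subexcedent w (pred j) × Subexcedent w (suc j)) ×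
   letter w (suc j) <⁺ letter w (pred j))

-- Case (c): the 0 at position j moves to the left.
MovesLeft : Word → Pred ℕ 0ℓ
MovesLeft w j =
  (Subexcedent w (pred j) × NonSubexcedent w (suc j)) ⊎
  ((Subexcedent w (pred j) × Subexcedent w (suc j)) ×
   letter w (pred j) <⁺ letter w (suc j))

-- xⱼ₊₁ < xⱼ₊₂ < ⋯ < xₖ < red(k) with k ≥ j + 1
RightRun : Word → ℕ → Pred ℕ 0ℓ
RightRun w j k = suc j ≤ k ×
  (∀ {t} → t < k → suc j ≤ t → letter w t <⁺ letter w (suc t)) ×
  letter w k <⁺ [ red w k ]

-- red(i) > xᵢ > xᵢ₊₁ > ⋯ > xⱼ₋₁ with i ≤ j - 1
LeftRun : Word → ℕ → Pred ℕ 0ℓ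
LeftRun w j i = i ≤ pred j ×
  (∀ {t} → t < pred j → i ≤ t → letter w (suc t) <⁺ letter w t) ×
  letter w i <⁺ [ red w i ]

_<⁺?_ : Decidable _<⁺_
_<⁺?_ = <⁺-dec _<?_

_≟⁺_ : Decidable {A = ℕ ⁺} _≡_
_≟⁺_ = ≡-dec _≟_

subexcedent? : ∀ w k → Dec (Subexcedent w k)
subexcedent? w k =
  ([ 0 ] <⁺? letter w k) ×-dec (letter w k <⁺? [ red w k ])

nonSubexcedent? : ∀ w k → Dec (NonSubexcedent w k)
nonSubexcedent? w k =
  (letter w k ≟⁺ [ 0 ]) ⊎-dec
  (([ 0 ] <⁺? letter w k) ×-dec ([ red w k ] <⁺? letter w k))

movesRight? : ∀ w j → Dec (MovesRight w j)
movesRight? w j =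
  (nonSubexcedent? w (pred j) ×-dec subexcedent? w (suc j)) ⊎-dec
  ((subexcedent? w (pred j) ×-dec subexcedent? w (suc j)) ×-dec
   (letter w (suc j) <⁺? letter w (pred j)))

movesLeft? : ∀ w j → Dec (MovesLeft w j)
movesLeft? w j =
  (subexcedent? w (pred j) ×-dec nonSubexcedent? w (suc j)) ⊎-dec
  ((subexcedent? w (pred j) ×-dec subexcedent? w (suc j)) ×-dec
   (letter w (pred j) <⁺? letter w (suc j)))

rightRun? : ∀ w j k → Dec (RightRun w j k)
rightRun? w j k = (suc j ≤? k) ×-dec
  allUpTo? (λ t → (suc j ≤? t) →-dec (letter w t <⁺? letter w (suc t))) k ×-dec
  (letter w k <⁺? [ red w k ])

leftRun? : ∀ w j i → Dec (LeftRun w j i)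
leftRun? w j i = (i ≤? pred j) ×-dec
  allUpTo? (λ t → (i ≤? t) →-dec (letter w (suc t) <⁺? letter w t)) (pred j) ×-dec
  (letter w i <⁺? [ red w i ])

-- The greatest k and the smallest i as above.  The default values j + 1 and
-- j - 1 are themselves admissible whenever xⱼ₊₁, respectively xⱼ₋₁, is
-- subexcedent, hence in every case where these functions are applied.
rightEnd leftEnd : Word → ℕ → ℕ
rightEnd w j = max (suc j) (filter (rightRun? w j) (positions w))
leftEnd  w j = min (pred j) (filter (leftRun? w j) (positions w))

-- x₁⋯xⱼ₋₁ xⱼ₊₁⋯xₖ 0 xₖ₊₁⋯xₙ
moveRight : Word → ℕ → ℕ → Word
moveRight w j k = take (pred j) w ++ drop j (take k w) ++ 0 ∷ drop k w

-- x₁⋯xᵢ₋₁ 0 xᵢ⋯xⱼ₋₁ xⱼ₊₁⋯xₙ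
moveLeft : Word → ℕ → ℕ → Word
moveLeft w j i =
  take (pred i) w ++ 0 ∷ drop (pred i) (take (pred j) w) ++ drop j w

-- On Sh(0ⁿ⁻ᵐ v), v a derangement, the neighbours of a 0 are never equal positive
-- letters and no positive letter equals red(k), so the last alternative is
-- exactly case (a).
moveZero : Word → ℕ → Word
moveZero w j =
  if does (movesRight? w j) then moveRight w j (rightEnd w j)
  else if does (movesLeft? w j) then moveLeft w j (leftEnd w j)
  else w

zeroPositions : Word → List ℕ
zeroPositions w = filter (λ i → letter w i ≟⁺ [ 0 ]) (positions w)

-- The l-th entry of zeroPositions w is the position of the l-th 0 of w; it is
-- ⊤⁺ when l exceeds the number of 0's, which is n - m for w in Sh(0ⁿ⁻ᵐ v).
φ : ℕ → Word → Word
φ l w with letter (zeroPositions w) l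
... | [ j ] = moveZero w j
... | ⊤⁺    = w

Φ : Word → Word
Φ w = foldr φ w (applyUpTo suc (length w))

BijectionOnto : Pred Word 0ℓ → (Word → Word) → Set
BijectionOnto S f =
  Σ[ closed ∈ (∀ {w} → w ∈ S → f w ∈ S) ]
    Bijective {A = Σ Word S} {B = Σ Word S}
      (_≡_ on proj₁) (_≡_ on proj₁) (λ (w , w∈S) → f w , closed w∈S)

{-# OPTIONS --safe #-}

-- Deal with one 0 at a time, from right to left, treating the other zeros as
-- walls.  When a 0 is inserted in all possible gaps of a word between two walls,
-- φ fixes the gaps whose two neighbours are not subexcedent and permutes
-- cyclically the gaps of every maximal subexcedent block; the cycle is run
-- backwards by the same rule for the opposite order of the letters.  So every φ_l
-- is a bijection.  If the zeros to the left of the moving one are read with the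
-- rule of RISE and those to its right with that of RISE•, then the set of rises
-- does not change when the moving 0 passes from the first rule to the second.

module Submission where

open import Defs
open import Data.Bool.Base using (Bool; true; false; not; _∧_; _∨_; if_then_else_; T)
open import Data.Empty using (⊥; ⊥-elim)
open import Data.List.Base
  using (List; []; _∷_; _++_; _ʳ++_; length; take; drop; filter; foldr; foldl; reverse; applyUpTo)
open import Data.List.Extrema.Nat using (max≈v⁺; min≈v⁺)
open import Data.List.Membership.Propositional using () renaming (_∈_ to _∈ₗ_)
open import Data.List.Membership.Propositional.Properties using (∈-filter⁺; ∈-applyUpTo⁺)
open import Data.List.Properties using (length-ʳ++; ʳ++-defn; ++-identityʳ; length-applyUpTo)
open import Data.List.Relation.Binary.Permutation.Propositional using (↭-sym; ↭⇒↭ₛ)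
open import Data.List.Relation.Binary.Permutation.Propositional.Properties using (↭-length)
open import Data.List.Relation.Binary.Permutation.Setoid.Properties using (Unique-resp-↭)
open import Data.List.Relation.Unary.All as All using ()
open import Data.List.Relation.Unary.All.Properties using (all-filter)
open import Data.List.Relation.Unary.AllPairs as AllPairs using ()
open import Data.List.Relation.Unary.Unique.Propositional using (Unique)
open import Data.List.Relation.Unary.Unique.Propositional.Properties using (applyUpTo⁺₁)
open import Data.Nat.Base
open import Data.Nat.Properties
open import Data.Product.Base using (Σ; ∃; _×_; _,_; proj₁; proj₂)
open import Data.Sum.Base using (_⊎_; inj₁; inj₂)
open import Data.Unit.Base using (⊤; tt)
open import Function.Base using (_∘_; flip)
open import Function.Bundles using (_⇔_; mk⇔; Equivalence)
open import Level using (0ℓ)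
open import Relation.Binary.Construct.Add.Supremum.NonStrict _≤_ using (_≤⁺_; [_]; _≤⊤⁺)
open import Relation.Binary.Construct.Add.Supremum.Strict _<_ using (_<⁺_; [_]; [_]<⊤⁺; <⁺-trans)
open import Relation.Binary.PropositionalEquality hiding ([_])
open import Relation.Nullary.Construct.Add.Supremum using (_⁺; [_]; ⊤⁺)
open import Relation.Nullary.Decidable.Core using (does)
open import Relation.Unary using (Pred; _∈_; _≐_)

-- Zeros do not count in `red`, so whether a positive letter is subexcedent depends on `Pos w` alone
-- and is never altered by a moving 0. The derangement enters through `Good`. The absence of fixed
-- letters makes a positive letter that is not subexcedent excedent; distinctness makes neighbouring
-- letters strictly comparable, so that a 0 between two subexcedent letters always moves, under
-- either order. The comparison of rises rests on one inequality. From one positive letter to the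
-- next, `red` grows by exactly 1, so a subexcedent letter followed by an excedent one is an ascent,
-- and an excedent letter followed by a subexcedent one is a descent. The definition of a run takes
-- an extremum over all positions and tests subexcedence only at the far end, whereas the walk used
-- here tests it at every letter. The two agree because subexcedence at the far end is inherited by
-- the whole run.

#pos #zero : Word → ℕ
#pos w  = length (Pos w)
#zero w = length (zeros w)

-- The letter x is subexcedent when p positive letters precede it.
sub : ℕ → ℕ → Bool
sub p zero    = false
sub p (suc x) = x <ᵇ p

Order : Set
Order = ℕ → ℕ → Bool

-- Moves of a marked 0

-- (ls , rs) stands for a word with a marked 0: ls is the part to the left of
-- that 0, read from right to left, and rs the part to its right.
Zipper : Set
Zipper = Word × Word

plug : Zipper → Word
plug (ls , rs) = ls ʳ++ 0 ∷ rs

-- The 0 has just jumped over x and goes on while the next letter is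
-- subexcedent and farther up in the order lt.
runR runL : Order → ℕ → Word → Word → Zipper
runR lt x ls []       = x ∷ ls , []
runR lt x ls (y ∷ rs) =
  if sub (#pos (x ∷ ls)) y ∧ lt x y then runR lt y (x ∷ ls) rs else (x ∷ ls , y ∷ rs)
runL lt x []       rs = [] , x ∷ rs
runL lt x (y ∷ ls) rs =
  if sub (#pos ls) y ∧ lt x y then runL lt y ls (x ∷ rs) else (y ∷ ls , x ∷ rs)

rightward leftward : Order → Word → Word → Bool
rightward lt ls       []       = false
rightward lt []       (y ∷ rs) = sub 0 y
rightward lt (x ∷ ls) (y ∷ rs) = sub (#pos (x ∷ ls)) y ∧ (not (sub (#pos ls) x) ∨ lt y x)
leftward lt []       rs       = false
leftward lt (x ∷ ls) []       = sub (#pos ls) x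
leftward lt (x ∷ ls) (y ∷ rs) = sub (#pos ls) x ∧ (not (sub (#pos (x ∷ ls)) y) ∨ lt x y)

goR goL : Order → Word → Word → Zipper
goR lt ls []       = ls , []
goR lt ls (y ∷ rs) = runR lt y ls rs
goL lt []       rs = [] , rs
goL lt (x ∷ ls) rs = runL lt x ls rs

move : Order → Word → Word → Zipper
move lt ls rs =
  if rightward lt ls rs then goR lt ls rs else if leftward lt ls rs then goL lt ls rs else (ls , rs)

sub-zero : ∀ x → sub 0 x ≡ false
sub-zero zero    = refl
sub-zero (suc x) = refl

-- The positive letters of plug (ls , rs).  This expression is definitionally
-- unchanged when a positive letter jumps over the marked 0.
letters : Word → Word → Word
letters ls rs = Pos ls ʳ++ Pos rs

NoFix : Word → Set
NoFix v = ∀ i → letter v i ≢ [ i ]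

Good : Word → Set
Good v = Unique v × NoFix v

unique-suffix : ∀ (xs : Word) {ys} → Unique (xs ʳ++ ys) → Unique ys
unique-suffix []       u = u
unique-suffix (x ∷ xs) u = AllPairs.tail (unique-suffix xs u)

adjacent : ∀ ls rs {x y} → Good (letters ls (suc x ∷ suc y ∷ rs)) → suc x ≢ suc y
adjacent ls rs (u , _) = All.head (AllPairs.head (unique-suffix (Pos ls) u))

-- Reversal of a move by the opposite order

record StrictTotal (lt : Order) : Set where
  field
    asym  : ∀ {x y} → lt x y ≡ true → lt y x ≡ false
    total : ∀ {x y} → x ≢ y → lt x y ≡ false → lt y x ≡ true
open StrictTotal

flip-total : ∀ {lt} → StrictTotal lt → StrictTotal (flip lt)
flip-total st .asym {x} {y} = asym st {y} {x}
flip-total st .total {x} {y} x≢y = total st {y} {x} (x≢y ∘ sym)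

module _ {lt : Order} (st : StrictTotal lt) where

  private tl = flip lt

  -- The condition that sent the 0 rightwards over `x` says that the letter before `x` is not
  -- subexcedent or lies above `x` in `lt`. Either one stops a leftward run in the opposite order.
  runL-stop : ∀ x ls rs → rightward lt ls (x ∷ rs) ≡ true → runL tl x ls rs ≡ (ls , x ∷ rs)
  runL-stop x []       rs _ = refl
  runL-stop x (y ∷ ls) rs e with sub (#pos (y ∷ ls)) x | sub (#pos ls) y | lt x y in x<y
  ... | true | false | _    = refl
  ... | true | true  | true rewrite asym st x<y = refl

  runR-stop : ∀ x ls rs → leftward lt (x ∷ ls) rs ≡ true → runR tl x ls rs ≡ (x ∷ ls , rs)
  runR-stop x ls []       _ = refl
  runR-stop x ls (y ∷ rs) e with sub (#pos ls) x | sub (#pos (x ∷ ls)) y | lt x y in x<y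
  ... | true | false | _    = refl
  ... | true | true  | true rewrite asym st x<y = refl

  -- At the far end of the run the letter ahead is missing, not subexcedent, or by totality below
  -- the last letter jumped. So the opposite rule turns the 0 back over the same letters, `x`
  -- included; `runL-stop` then decides that it goes no farther.
  runR-back : ∀ x ls rs → Good (letters ls (x ∷ rs)) → sub (#pos ls) x ≡ true →
              (λ (ls′ , rs′) → move tl ls′ rs′) (runR lt x ls rs) ≡ runL tl x ls rs
  runR-back (suc x) ls []       g e rewrite e = refl
  runR-back (suc x) ls (zero ∷ rs) g e rewrite e = refl
  runR-back (suc x) ls (suc y ∷ rs) g e
    with sub (suc (#pos ls)) (suc y) in e₁ | lt (suc x) (suc y) in e₂
  ... | true  | true rewrite runR-back (suc y) (suc x ∷ ls) rs g e₁ | e | e₂ = refl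
  ... | true  | false rewrite e₁ | e | e₂ | total st (adjacent ls rs g) e₂ = refl
  ... | false | _ rewrite e₁ | e = refl

  runL-back : ∀ x ls rs → Good (letters ls (x ∷ rs)) → sub (#pos ls) x ≡ true →
              (λ (ls′ , rs′) → move tl ls′ rs′) (runL lt x ls rs) ≡ runR tl x ls rs
  runL-back x [] rs g e with () ← trans (sym e) (sub-zero x)
  runL-back (suc x) (zero ∷ ls) rs g e rewrite e = refl
  runL-back (suc x) (suc y ∷ ls) rs g e
    with sub (#pos ls) (suc y) in e₁ | lt (suc x) (suc y) in e₂
  ... | true  | true rewrite runL-back (suc y) ls (suc x ∷ rs) g e₁ | e | e₂ = refl
  ... | true  | false rewrite e | e₁ | total st (adjacent ls rs g ∘ sym) e₂ = refl
  ... | false | _ rewrite e | e₁ = refl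

rightward⇒sub : ∀ lt ls y rs → rightward lt ls (y ∷ rs) ≡ true → sub (#pos ls) y ≡ true
rightward⇒sub lt []       y rs e = e
rightward⇒sub lt (x ∷ ls) y rs e with sub (#pos (x ∷ ls)) y
... | true = refl

leftward⇒sub : ∀ lt x ls rs → leftward lt (x ∷ ls) rs ≡ true → sub (#pos ls) x ≡ true
leftward⇒sub lt x ls []       e = e
leftward⇒sub lt x ls (y ∷ rs) e with sub (#pos ls) x
... | true = refl

subL : Word → Bool
subL []       = false
subL (x ∷ ls) = sub (#pos ls) x

subR : Word → Word → Bool
subR ls []       = false
subR ls (y ∷ rs) = sub (#pos ls) y

-- Two subexcedent neighbours are distinct, so one of the two comparisons holds and the 0 would
-- move.
rest⇒nonsub : ∀ {lt} → StrictTotal lt → ∀ ls rs → Good (letters ls rs) →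
  rightward lt ls rs ≡ false → leftward lt ls rs ≡ false → subL ls ≡ false × subR ls rs ≡ false
rest⇒nonsub st []       []       g r l = refl , refl
rest⇒nonsub st []       (y ∷ rs) g r l = refl , r
rest⇒nonsub st (x ∷ ls) []       g r l = l , refl
rest⇒nonsub {lt} st (zero ∷ ls) (y ∷ rs) g r l with sub (#pos ls) y
... | false = refl , refl
rest⇒nonsub {lt} st (suc x ∷ ls) (zero ∷ rs) g r l with sub (#pos ls) (suc x)
... | false = refl , refl
rest⇒nonsub {lt} st (suc x ∷ ls) (suc y ∷ rs) g r l
  with sub (#pos ls) (suc x) | sub (suc (#pos ls)) (suc y) | lt (suc y) (suc x) in e
... | false | false | _ = refl , refl
... | true  | true  | false with () ← trans (sym l) (total st (adjacent ls rs g ∘ sym) e)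

nonsub⇒rest : ∀ lt ls rs → subL ls ≡ false → subR ls rs ≡ false → move lt ls rs ≡ (ls , rs)
nonsub⇒rest lt []       []       l r = refl
nonsub⇒rest lt []       (y ∷ rs) l r rewrite r = refl
nonsub⇒rest lt (x ∷ ls) []       l r rewrite l = refl
nonsub⇒rest lt (x ∷ ls) (y ∷ rs) l r rewrite l | r = refl

data Moved (lt : Order) : Word → Word → Zipper → Set where
  right : ∀ {ls y rs} → rightward lt ls (y ∷ rs) ≡ true → Moved lt ls (y ∷ rs) (runR lt y ls rs)
  left  : ∀ {x ls rs} → leftward lt (x ∷ ls) rs ≡ true →
          Moved lt (x ∷ ls) rs (runL lt x ls rs)
  rest  : ∀ {ls rs} → subL ls ≡ false → subR ls rs ≡ false → Moved lt ls rs (ls , rs)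

moved : ∀ {lt} → StrictTotal lt → ∀ ls rs → Good (letters ls rs) → Moved lt ls rs (move lt ls rs)
moved {lt} st ls rs g with rightward lt ls rs in r | leftward lt ls rs in l
moved st ls (y ∷ rs) g | true  | _     = right r
moved st (x ∷ ls) rs g | false | true  = left l
moved st ls rs g       | false | false = let a , b = rest⇒nonsub st ls rs g r l in rest a b

move-flip : ∀ {lt} → StrictTotal lt → ∀ ls rs → Good (letters ls rs) →
            (λ (ls′ , rs′) → move (flip lt) ls′ rs′) (move lt ls rs) ≡ (ls , rs)
move-flip {lt} st ls rs g with move lt ls rs | moved st ls rs g
... | _ | right {y = y} {rs = rs′} e =
  trans (runR-back st y ls rs′ g (rightward⇒sub lt ls y rs′ e)) (runL-stop st y ls rs′ e)
move-flip {lt} st (suc x ∷ ls) rs g | _ | left e =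
  trans (runL-back st (suc x) ls rs g (leftward⇒sub lt (suc x) ls rs e)) (runR-stop st (suc x) ls rs e)
move-flip {lt} st (zero ∷ ls) rs g | _ | left e with () ← leftward⇒sub lt zero ls rs e
move-flip {lt} st ls rs g | _ | rest l r = nonsub⇒rest (flip lt) ls rs l r

-- Invariants of a move

infix 4 _≈z_
-- Zeros are counted on each side separately, so that the moving 0 keeps its rank among all zeros.
_≈z_ : Zipper → Zipper → Set
(ls , rs) ≈z (ls′ , rs′) =
  #zero ls ≡ #zero ls′ × #zero rs ≡ #zero rs′ × letters ls rs ≡ letters ls′ rs′

runR-≈ : ∀ lt x ls rs → sub (#pos ls) x ≡ true → runR lt x ls rs ≈z (ls , x ∷ rs)
runR-≈ lt (suc x) ls []       e = refl , refl , refl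
runR-≈ lt (suc x) ls (y ∷ rs) e with sub (suc (#pos ls)) y in e₁ | lt (suc x) y
runR-≈ lt (suc x) ls (suc y ∷ rs) e | true | true = runR-≈ lt (suc y) (suc x ∷ ls) rs e₁
... | true | false = refl , refl , refl
... | false | _ = refl , refl , refl

runL-≈ : ∀ lt x ls rs → sub (#pos ls) x ≡ true → runL lt x ls rs ≈z (x ∷ ls , rs)
runL-≈ lt (suc x) []       rs e = refl , refl , refl
runL-≈ lt (suc x) (y ∷ ls) rs e with sub (#pos ls) y in e₁ | lt (suc x) y
runL-≈ lt (suc x) (suc y ∷ ls) rs e | true | true = runL-≈ lt (suc y) ls (suc x ∷ rs) e₁
... | true | false = refl , refl , refl
... | false | _ = refl , refl , refl

move-≈ : ∀ {lt} → StrictTotal lt → ∀ ls rs → Good (letters ls rs) → move lt ls rs ≈z (ls , rs)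
move-≈ {lt} st ls rs g with move lt ls rs | moved st ls rs g
... | _ | right {y = y} {rs = rs′} e = runR-≈ lt y ls rs′ (rightward⇒sub lt ls y rs′ e)
... | _ | left {x} {ls′} e = runL-≈ lt x ls′ rs (leftward⇒sub lt x ls′ rs e)
... | _ | rest _ _ = refl , refl , refl

-- The usual order, and ascents forced by subexcedence

true⇒< : ∀ {x y} → (x <ᵇ y) ≡ true → x < y
true⇒< {x} {y} e = <ᵇ⇒< x y (subst T (sym e) tt)

false⇒≥ : ∀ {x y} → (x <ᵇ y) ≡ false → y ≤ x
false⇒≥ e = ≮⇒≥ λ x<y → subst T e (<⇒<ᵇ x<y)

<⇒true : ∀ {x y} → x < y → (x <ᵇ y) ≡ true
<⇒true {x} {y} x<y with x <ᵇ y | <⇒<ᵇ x<y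
... | true | _ = refl

≥⇒false : ∀ {x y} → y ≤ x → (x <ᵇ y) ≡ false
≥⇒false {x} {y} y≤x with x <ᵇ y in e
... | false = refl
... | true  = ⊥-elim (<⇒≱ (true⇒< e) y≤x)

<ᵇ-strictTotal : StrictTotal _<ᵇ_
<ᵇ-strictTotal .asym {x} {y} e = ≥⇒false (<⇒≤ (true⇒< {x} {y} e))
<ᵇ-strictTotal .total {x} {y} x≢y e = <⇒true (≤∧≢⇒< (false⇒≥ {x} {y} e) (x≢y ∘ sym))

-- The letters meant are `suc x` and `suc y`, with `p` and `suc p` positive letters before them;
-- hence `x < p < y`.
sub<nonsub : ∀ x y p → (x <ᵇ p) ≡ true → (y <ᵇ suc p) ≡ false → (x <ᵇ y) ≡ true
sub<nonsub x y p e e′ = <⇒true (<-trans (true⇒< {x} {p} e) (false⇒≥ {y} {suc p} e′))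

nonsub≮sub : ∀ x y p → (x <ᵇ p) ≡ false → (y <ᵇ suc p) ≡ true → (x <ᵇ y) ≡ false
nonsub≮sub x y p e e′ = ≥⇒false (≤-trans (s≤s⁻¹ (true⇒< {y} {suc p} e′)) (false⇒≥ {x} {p} e))

-- The interpolating statistic and its invariance under a move

-- A statistic interpolating between RISE and RISE•: the first l zeros obey the
-- rule of RISE, the others that of RISE•.  In marks l p w the word w is preceded
-- by p positive letters.
zrise : ℕ → ℕ → Word → Bool
zrise (suc l) p w       = true
zrise zero    p []      = true
zrise zero    p (y ∷ w) = not (sub p y)

-- A positive letter in front of a 0 follows the rule of that 0. Between positive letters the two
-- rules agree, since neighbours are distinct.
prise : ℕ → ℕ → ℕ → Word → Bool
prise l       p x []          = true
prise l       p x (suc y ∷ w) = x <ᵇ suc y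
prise zero    p x (zero ∷ w)  = sub p x
prise (suc l) p x (zero ∷ w)  = false

marks : ℕ → ℕ → Word → List Bool
marks l p []          = []
marks l p (zero ∷ w)  = zrise l p w ∷ marks (pred l) p w
marks l p (suc x ∷ w) = prise l p (suc x) w ∷ marks l (suc p) w

-- The letter before A and B, which is the head of the reversed prefix, has the
-- same mark in front of either.
SameRise : Word → ℕ → Word → ℕ → Word → Set
SameRise []           l A l′ B = ⊤
SameRise (zero ∷ ls)  l A l′ B = ⊤
SameRise (suc x ∷ ls) l A l′ B = prise l (#pos ls) (suc x) A ≡ prise l′ (#pos ls) (suc x) B

sameRise : ∀ ls {l A l′ B} → (∀ p x → prise l p x A ≡ prise l′ p x B) → SameRise ls l A l′ B
sameRise []           e = tt
sameRise (zero ∷ ls)  e = tt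
sameRise (suc x ∷ ls) e = e (#pos ls) (suc x)

-- A mark looks only one letter ahead, so a change of suffix can affect just the last letter of the
-- prefix, which `SameRise` controls. A 0 of the prefix obeys RISE and is always marked.
marks-ʳ++ : ∀ ls {l A l′ B} → SameRise ls l A l′ B →
  marks l (#pos ls) A ≡ marks l′ (#pos ls) B →
  marks (#zero ls + l) 0 (ls ʳ++ A) ≡ marks (#zero ls + l′) 0 (ls ʳ++ B)
marks-ʳ++ [] _ e = e
marks-ʳ++ (zero ∷ ls) {l} {A} {l′} {B} _ e
  rewrite sym (+-suc (#zero ls) l) | sym (+-suc (#zero ls) l′) =
  marks-ʳ++ ls (sameRise ls {suc l} {0 ∷ A} {suc l′} {0 ∷ B} (λ _ _ → refl)) (cong (true ∷_) e)
marks-ʳ++ (suc x ∷ ls) {l} {A} {l′} {B} h e =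
  marks-ʳ++ ls (sameRise ls {l} {suc x ∷ A} {l′} {suc x ∷ B} (λ _ _ → refl)) (cong₂ _∷_ h e)

reach : Order → ℕ → ℕ → Word → ℕ
reach lt p x []       = 0
reach lt p x (y ∷ rs) = if sub (suc p) y ∧ lt x y then suc (reach lt (suc p) y rs) else 0

insert0 : ℕ → Word → Word
insert0 n w = take n w ++ 0 ∷ drop n w

plug-runR : ∀ lt x ls rs → sub (#pos ls) x ≡ true →
  plug (runR lt x ls rs) ≡ ls ʳ++ insert0 (suc (reach lt (#pos ls) x rs)) (x ∷ rs)
plug-runR lt (suc x) ls []       e = refl
plug-runR lt (suc x) ls (y ∷ rs) e with sub (suc (#pos ls)) y in e₁ | lt (suc x) y
... | true  | true  = plug-runR lt y (suc x ∷ ls) rs e₁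
... | true  | false = refl
... | false | _     = refl

-- The marks of the run move one place to the left: `true` for the RISE 0 and the ascents becomes
-- `true` for the ascents and for the last letter, now subexcedent before a 0. The mark that told
-- whether this last letter rises becomes that of the 0. A subexcedent successor lies below and
-- leaves both unmarked; any other, or none, marks both.
marks-insert : ∀ p x rs → sub p x ≡ true →
  marks 1 p (0 ∷ x ∷ rs) ≡ marks 0 p (insert0 (suc (reach _<ᵇ_ p x rs)) (x ∷ rs))
marks-insert p (suc x) []          e rewrite e = refl
marks-insert p (suc x) (zero ∷ rs) e rewrite e = refl
marks-insert p (suc x) (suc y ∷ rs) e with sub (suc p) (suc y) in e₁ | x <ᵇ y in e₂
... | true  | true  rewrite e₂ = cong (true ∷_) (marks-insert (suc p) (suc y) rs e₁)
... | true  | false rewrite e₁ | e = refl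
... | false | false
  with () ← trans (sym e₂) (sub<nonsub x y p e e₁)
... | false | true rewrite e₁ | e = refl

-- A positive letter in front of the RISE 0 is unmarked. After the move it stands before `y`, and
-- the condition for going right makes this a descent.
marks-right : ∀ ls y rs → rightward _<ᵇ_ ls (y ∷ rs) ≡ true →
  marks (#zero ls + 1) 0 (plug (ls , y ∷ rs)) ≡ marks (#zero ls + 0) 0 (plug (runR _<ᵇ_ y ls rs))
marks-right ls y rs e rewrite plug-runR _<ᵇ_ y ls rs (rightward⇒sub _<ᵇ_ ls y rs e) =
  marks-ʳ++ ls (same ls y e) (marks-insert (#pos ls) y rs (rightward⇒sub _<ᵇ_ ls y rs e))
  where
  same : ∀ ls y {A B} → rightward _<ᵇ_ ls (y ∷ rs) ≡ true → SameRise ls 1 (0 ∷ A) 0 (y ∷ B)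
  same []           y       e = tt
  same (zero ∷ ls)  y       e = tt
  same (suc x ∷ ls) (suc y) e
    with sub (suc (#pos ls)) (suc y) in e₁ | sub (#pos ls) (suc x) in e₂ | y <ᵇ x in e₃
  ... | true | true  | true = sym (asym <ᵇ-strictTotal {y} {x} e₃)
  ... | true | false | _    = sym (nonsub≮sub x y (#pos ls) e₂ e₁)

-- x ∷ W is the original suffix, x ∷ rs the same suffix without its moving 0.
marks-runL : ∀ x ls rs W → Good (letters ls (x ∷ rs)) → sub (#pos ls) x ≡ true →
  marks 1 (#pos ls) (x ∷ W) ≡ marks 0 (#pos ls) (0 ∷ x ∷ rs) →
  marks (#zero ls + 1) 0 (ls ʳ++ x ∷ W) ≡ marks (#zero ls + 0) 0 (plug (runL _<ᵇ_ x ls rs))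
marks-runL (suc x) []          rs W g e h = h
marks-runL (suc x) (zero ∷ ls) rs W g e h = marks-ʳ++ (0 ∷ ls) tt h
marks-runL (suc x) (suc y ∷ ls) rs W g e h
  with sub (#pos ls) (suc y) in e₁ | x <ᵇ y in e₂
... | true  | true  = marks-runL (suc y) ls (suc x ∷ rs) (suc x ∷ W) g e₁ step
  where
  step : marks 1 (#pos ls) (suc y ∷ suc x ∷ W) ≡ marks 0 (#pos ls) (0 ∷ suc y ∷ suc x ∷ rs)
  -- Both lists begin with two unmarked places: `suc y` falls to `suc x`, and each 0 stands before a
  -- subexcedent letter.
  step rewrite e₁ | h | e | asym <ᵇ-strictTotal {x} {y} e₂ = refl
-- The run stops at `suc y`, now in front of the 0: it is subexcedent exactly when it rose to
-- `suc x`.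
... | true  | false = marks-ʳ++ (suc y ∷ ls) {1} {_} {0}
  (trans (total <ᵇ-strictTotal {x} {y} (λ x≡y → adjacent ls rs g (cong suc (sym x≡y))) e₂) (sym e₁)) h
... | false | _     = marks-ʳ++ (suc y ∷ ls) {1} {_} {0}
  (trans (nonsub≮sub y x (#pos ls) e₁ e) (sym e₁)) h

marks-left : ∀ x ls rs → Good (letters (x ∷ ls) rs) → leftward _<ᵇ_ (x ∷ ls) rs ≡ true →
  marks (#zero (x ∷ ls) + 1) 0 (plug (x ∷ ls , rs)) ≡
  marks (#zero (x ∷ ls) + 0) 0 (plug (runL _<ᵇ_ x ls rs))
marks-left zero    ls rs g e with () ← leftward⇒sub _<ᵇ_ zero ls rs e
marks-left (suc x) ls rs g e =
  marks-runL (suc x) ls rs (0 ∷ rs) g e₁ (start rs e)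
  where
  e₁ = leftward⇒sub _<ᵇ_ (suc x) ls rs e
  start : ∀ rs → leftward _<ᵇ_ (suc x ∷ ls) rs ≡ true →
    marks 1 (#pos ls) (suc x ∷ 0 ∷ rs) ≡ marks 0 (#pos ls) (0 ∷ suc x ∷ rs)
  start []           e rewrite e₁ = refl
  start (zero ∷ rs)  e rewrite e₁ = refl
  start (suc y ∷ rs) e with sub (suc (#pos ls)) (suc y) in e₂ | x <ᵇ y in e₃
  ... | true  | true  rewrite e₁ = refl
  ... | true  | false rewrite e₁ with () ← e
  ... | false | true  rewrite e₁ = refl
  ... | false | false
    with () ← trans (sym e₃) (sub<nonsub x y (#pos ls) e₁ e₂)

marks-rest : ∀ ls rs → subL ls ≡ false → subR ls rs ≡ false →
  marks (#zero ls + 1) 0 (plug (ls , rs)) ≡ marks (#zero ls + 0) 0 (plug (ls , rs))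
marks-rest ls rs l r = marks-ʳ++ ls (same ls l) (cong (_∷ marks 0 (#pos ls) rs) (zr rs r))
  where
  same : ∀ ls → subL ls ≡ false → SameRise ls 1 (0 ∷ rs) 0 (0 ∷ rs)
  same []           l = tt
  same (zero ∷ ls)  l = tt
  same (suc x ∷ ls) l = sym l
  zr : ∀ rs → subR ls rs ≡ false → true ≡ zrise 0 (#pos ls) rs
  zr []       r = refl
  zr (y ∷ rs) r rewrite r = refl

marks-move : ∀ ls rs → Good (letters ls rs) →
  marks (suc (#zero ls)) 0 (plug (ls , rs)) ≡ marks (#zero ls) 0 (plug (move _<ᵇ_ ls rs))
marks-move ls rs g = subst₂ (λ a b → marks a 0 (plug (ls , rs)) ≡ marks b 0 (plug (move _<ᵇ_ ls rs)))
  (+-comm (#zero ls) 1) (+-identityʳ (#zero ls)) main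
  where
  main : marks (#zero ls + 1) 0 (plug (ls , rs)) ≡ marks (#zero ls + 0) 0 (plug (move _<ᵇ_ ls rs))
  main with move _<ᵇ_ ls rs | moved <ᵇ-strictTotal ls rs g
  ... | _ | right {y = y} {rs = rs′} e = marks-right ls y rs′ e
  ... | _ | left {x} {ls′} e = marks-left x ls′ rs g e
  ... | _ | rest l r = marks-rest ls rs l r

-- Needed for the levels with no 0 to move, where `φ` is the identity.
marks-saturated : ∀ l p w → #zero w ≤ l → marks (suc l) p w ≡ marks l p w
marks-saturated l       p []              _ = refl
marks-saturated (suc l) p (zero ∷ w) (s≤s b) = cong (true ∷_) (marks-saturated l p w b)
marks-saturated l p (suc x ∷ w) b = cong₂ _∷_ (same l w b) (marks-saturated l (suc p) w b)
  where
  same : ∀ l w → #zero w ≤ l → prise (suc l) p (suc x) w ≡ prise l p (suc x) w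
  same l       []          _ = refl
  same (suc l) (zero ∷ w)  _ = refl
  same l       (suc y ∷ w) _ = refl

-- Letters, factors and `red` of a word cut at a position

letter-ʳ++ : ∀ ls i ys → letter (ls ʳ++ ys) (suc (length ls + i)) ≡ letter ys (suc i)
letter-ʳ++ []       i ys = refl
letter-ʳ++ (x ∷ ls) i ys rewrite sym (+-suc (length ls) i) = letter-ʳ++ ls (suc i) (x ∷ ys)

letter-first : ∀ ls ys → letter (ls ʳ++ ys) (suc (length ls)) ≡ letter ys 1
letter-first ls ys rewrite sym (letter-ʳ++ ls 0 ys) | +-identityʳ (length ls) = refl

letter-second : ∀ ls x ys → letter (ls ʳ++ x ∷ ys) (suc (suc (length ls))) ≡ letter ys 1
letter-second ls x ys = letter-first (x ∷ ls) ys

letter-last : ∀ ls ys → letter (ls ʳ++ ys) (length ls) ≡ letter ls 1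
letter-last []       ys = refl
letter-last (x ∷ ls) ys = letter-first ls (x ∷ ys)

take-ʳ++ : ∀ (ls : Word) i ys → take (length ls + i) (ls ʳ++ ys) ≡ ls ʳ++ take i ys
take-ʳ++ []       i ys = refl
take-ʳ++ (x ∷ ls) i ys rewrite sym (+-suc (length ls) i) = take-ʳ++ ls (suc i) (x ∷ ys)

drop-ʳ++ : ∀ (ls : Word) i ys → drop (length ls + i) (ls ʳ++ ys) ≡ drop i ys
drop-ʳ++ []       i ys = refl
drop-ʳ++ (x ∷ ls) i ys rewrite sym (+-suc (length ls) i) = drop-ʳ++ ls (suc i) (x ∷ ys)

take-length-ʳ++ : ∀ (ls : Word) ys → take (length ls) (ls ʳ++ ys) ≡ ls ʳ++ []
take-length-ʳ++ ls ys = trans (cong (λ n → take n (ls ʳ++ ys)) (sym (+-identityʳ (length ls)))) (take-ʳ++ ls 0 ys)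

drop-length-ʳ++ : ∀ (ls : Word) ys → drop (length ls) (ls ʳ++ ys) ≡ ys
drop-length-ʳ++ ls ys = trans (cong (λ n → drop n (ls ʳ++ ys)) (sym (+-identityʳ (length ls)))) (drop-ʳ++ ls 0 ys)

ʳ++-[]-++ : ∀ (ls : Word) {ys} → (ls ʳ++ []) ++ ys ≡ ls ʳ++ ys
ʳ++-[]-++ ls {ys} = trans (cong (_++ ys) (ʳ++-defn ls))
  (trans (cong (_++ ys) (++-identityʳ (reverse ls))) (sym (ʳ++-defn ls)))

Pos-ʳ++ : ∀ ls ys → Pos (ls ʳ++ ys) ≡ letters ls ys
Pos-ʳ++ []           ys = refl
Pos-ʳ++ (zero ∷ ls)  ys = Pos-ʳ++ ls (0 ∷ ys)
Pos-ʳ++ (suc x ∷ ls) ys = Pos-ʳ++ ls (suc x ∷ ys)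

#zero-ʳ++ : ∀ ls ys → #zero (ls ʳ++ ys) ≡ #zero ls + #zero ys
#zero-ʳ++ []           ys = refl
#zero-ʳ++ (zero ∷ ls)  ys = trans (#zero-ʳ++ ls (0 ∷ ys)) (+-suc (#zero ls) (#zero ys))
#zero-ʳ++ (suc x ∷ ls) ys = #zero-ʳ++ ls (suc x ∷ ys)

red-ʳ++ : ∀ ls i ys → red (ls ʳ++ ys) (length ls + i) ≡ #pos ls + #pos (take i ys)
red-ʳ++ ls i ys rewrite take-ʳ++ ls i ys | Pos-ʳ++ ls (take i ys) = length-ʳ++ (Pos ls)

red-last : ∀ ls ys → red (ls ʳ++ ys) (length ls) ≡ #pos ls
red-last ls ys = begin
  red (ls ʳ++ ys) (length ls)      ≡⟨ cong (red (ls ʳ++ ys)) (sym (+-identityʳ (length ls))) ⟩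
  red (ls ʳ++ ys) (length ls + 0)  ≡⟨ red-ʳ++ ls 0 ys ⟩
  #pos ls + 0                      ≡⟨ +-identityʳ (#pos ls) ⟩
  #pos ls                          ∎
  where open ≡-Reasoning

red-first : ∀ ls y ys → red (ls ʳ++ y ∷ ys) (suc (length ls)) ≡ #pos (y ∷ ls)
red-first ls y ys = red-last (y ∷ ls) ys

-- Otherwise `suc x` would be its own index in the word of positive letters.
nofix : ∀ ls rs {x} → NoFix (letters ls (suc x ∷ rs)) → x ≢ #pos ls
nofix ls rs {x} nf refl = nf (suc (length (Pos ls))) (letter-first (Pos ls) (suc x ∷ Pos rs))

<ᵇ-flip : ∀ {x y} → x ≢ y → (y <ᵇ x) ≡ not (x <ᵇ y)
<ᵇ-flip {x} {y} x≢y with x <ᵇ y in e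
... | true  = asym <ᵇ-strictTotal {x} {y} e
... | false = total <ᵇ-strictTotal {x} {y} x≢y e

-- Agreement with the prescribed direction of the move

-- The deciders of Defs as functions of the letters and values of red alone.
subᵇ nonsubᵇ : ℕ ⁺ → ℕ → Bool
subᵇ a r    = does ([ 0 ] <⁺? a) ∧ does (a <⁺? [ r ])
nonsubᵇ a r = does (a ≟⁺ [ 0 ]) ∨ (does ([ 0 ] <⁺? a) ∧ does ([ r ] <⁺? a))

movesRightᵇ movesLeftᵇ : ℕ ⁺ → ℕ → ℕ ⁺ → ℕ → Bool
movesRightᵇ a r b s =
  (nonsubᵇ a r ∧ subᵇ b s) ∨ ((subᵇ a r ∧ subᵇ b s) ∧ does (b <⁺? a))
movesLeftᵇ a r b s =
  (subᵇ a r ∧ nonsubᵇ b s) ∨ ((subᵇ a r ∧ subᵇ b s) ∧ does (a <⁺? b))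

movesRightᵇ≡rightward : ∀ ls rs → Good (letters ls rs) →
  movesRightᵇ (letter ls 1) (#pos ls) (letter rs 1) (#pos ls + #pos (take 1 rs)) ≡ rightward _<ᵇ_ ls rs
movesRightᵇ≡rightward []           []           _ = refl
movesRightᵇ≡rightward []           (zero ∷ rs)  _ = refl
movesRightᵇ≡rightward []           (suc y ∷ rs) _ = refl
movesRightᵇ≡rightward (zero ∷ ls)  []           _ = refl
movesRightᵇ≡rightward (zero ∷ ls)  (zero ∷ rs)  _ = refl
movesRightᵇ≡rightward (zero ∷ ls)  (suc y ∷ rs) _ rewrite +-comm (#pos ls) 1 with y <ᵇ #pos ls
... | true  = refl
... | false = refl
movesRightᵇ≡rightward (suc x ∷ ls) []           _ with #pos ls <ᵇ x | x <ᵇ #pos ls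
... | true  | true  = refl
... | true  | false = refl
... | false | true  = refl
... | false | false = refl
movesRightᵇ≡rightward (suc x ∷ ls) (zero ∷ rs)  _ with #pos ls <ᵇ x | x <ᵇ #pos ls
... | true  | true  = refl
... | true  | false = refl
... | false | true  = refl
... | false | false = refl
-- Since no letter is fixed, excedent is rewritten as the negation of subexcedent.
movesRightᵇ≡rightward (suc x ∷ ls) (suc y ∷ rs) (_ , nf)
  rewrite +-comm (#pos ls) 1 | <ᵇ-flip (nofix ls (suc y ∷ rs) nf)
  with x <ᵇ #pos ls | y <ᵇ suc (#pos ls) | y <ᵇ x
... | true  | true  | true  = refl
... | true  | true  | false = refl
... | true  | false | _     = refl
... | false | true  | _     = refl
... | false | false | _     = refl

movesLeftᵇ≡leftward : ∀ ls rs → Good (letters ls rs) →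
  movesLeftᵇ (letter ls 1) (#pos ls) (letter rs 1) (#pos ls + #pos (take 1 rs)) ≡ leftward _<ᵇ_ ls rs
movesLeftᵇ≡leftward []           rs           _ = refl
movesLeftᵇ≡leftward (zero ∷ ls)  []           _ = refl
movesLeftᵇ≡leftward (zero ∷ ls)  (y ∷ rs)     _ = refl
movesLeftᵇ≡leftward (suc x ∷ ls) []           _ with x <ᵇ #pos ls
... | true  = refl
... | false = refl
movesLeftᵇ≡leftward (suc x ∷ ls) (zero ∷ rs)  _ with x <ᵇ #pos ls
... | true  = refl
... | false = refl
movesLeftᵇ≡leftward (suc x ∷ ls) (suc y ∷ rs) (_ , nf)
  rewrite +-comm (#pos ls) 1 | <ᵇ-flip (nofix (suc x ∷ ls) rs {y} nf)
  with x <ᵇ #pos ls | y <ᵇ suc (#pos ls) | x <ᵇ y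
... | true  | true  | true  = refl
... | true  | true  | false = refl
... | true  | false | _     = refl
... | false | _     | _     = refl

module _ (ls rs : Word) (g : Good (letters ls rs)) where

  private
    w = plug (ls , rs)
    j = suc (length ls)

    red-second : red w (suc j) ≡ #pos ls + #pos (take 1 rs)
    red-second = trans (cong (red w) (+-comm 2 (length ls))) (red-ʳ++ ls 2 (0 ∷ rs))

  -- The left side computes to `movesRightᵇ` of two letters and two values of `red`, so it suffices
  -- to replace these four arguments.
  does-movesRight : does (movesRight? w j) ≡ rightward _<ᵇ_ ls rs
  does-movesRight = trans
    (cong₂ (λ f s → f s)
      (cong₂ (λ f b → f b) (cong₂ movesRightᵇ (letter-last ls (0 ∷ rs)) (red-last ls (0 ∷ rs)))
        (letter-second ls 0 rs)) red-second)
    (movesRightᵇ≡rightward ls rs g)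

  does-movesLeft : does (movesLeft? w j) ≡ leftward _<ᵇ_ ls rs
  does-movesLeft = trans
    (cong₂ (λ f s → f s)
      (cong₂ (λ f b → f b) (cong₂ movesLeftᵇ (letter-last ls (0 ∷ rs)) (red-last ls (0 ∷ rs)))
        (letter-second ls 0 rs)) red-second)
    (movesLeftᵇ≡leftward ls rs g)

-- Extremal ends of runs

red-suc : ∀ w i → red w i ≤ red w (suc i) × red w (suc i) ≤ suc (red w i)
red-suc []          zero    = z≤n , z≤n
red-suc []          (suc i) = z≤n , z≤n
red-suc (zero ∷ w)  zero    = z≤n , z≤n
red-suc (suc x ∷ w) zero    = z≤n , s≤s z≤n
red-suc (zero ∷ w)  (suc i) = red-suc w i
red-suc (suc x ∷ w) (suc i) = let a , b = red-suc w i in s≤s a , s≤s b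

<⁺-below : ∀ {a b r s} → a <⁺ b → b <⁺ [ s ] → s ≤ suc r → a <⁺ [ r ]
<⁺-below [ a<b ] [ b<s ] s≤ = [ ≤-trans a<b (s≤s⁻¹ (≤-trans b<s s≤)) ]

<⁺-≤ : ∀ {a r s} → a <⁺ [ r ] → r ≤ s → a <⁺ [ s ]
<⁺-≤ [ a<r ] r≤s = [ ≤-trans a<r r≤s ]

letter-bound : ∀ w k {b} → letter w k <⁺ b → 1 ≤ k × k ≤ length w
letter-bound []      zero          ()
letter-bound []      (suc k)       ()
letter-bound (x ∷ w) zero          ()
letter-bound (x ∷ w) (suc zero)    _ = s≤s z≤n , s≤s z≤n
letter-bound (x ∷ w) (suc (suc k)) p = s≤s z≤n , s≤s (proj₂ (letter-bound w (suc k) p))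

∈-positions : ∀ w {k} → 1 ≤ k × k ≤ length w → k ∈ₗ positions w
∈-positions w {suc k} (_ , k≤) = ∈-applyUpTo⁺ suc k≤

rightRun-extend : ∀ w j {k} → letter w (suc j) <⁺ letter w (suc (suc j)) →
  RightRun w (suc j) k → RightRun w j k
rightRun-extend w j {k} rise (j<k , run , end) = ≤-trans (n≤1+n _) j<k , run′ , end
  where
  run′ : ∀ {t} → t < k → suc j ≤ t → letter w t <⁺ letter w (suc t)
  run′ t<k j<t with m≤n⇒m<n∨m≡n j<t
  ... | inj₁ j<t′ = run t<k j<t′
  ... | inj₂ refl = rise

rightRun-shrink : ∀ w j {k} → suc j < k → RightRun w j k → RightRun w (suc j) k
rightRun-shrink w j j<k (_ , run , end) = j<k , (λ t<k j<t → run t<k (≤-trans (n≤1+n _) j<t)) , end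

-- Subexcedence propagates backwards along a rising run, since red grows by at
-- most 1 at each step.
rightRun-sub : ∀ w d j → RightRun w j (suc j + d) → letter w (suc j) <⁺ [ red w (suc j) ]
rightRun-sub w zero    j (_ , _ , end) =
  subst (λ k → letter w k <⁺ [ red w k ]) (+-identityʳ (suc j)) end
rightRun-sub w (suc d) j r@(_ , run , _) = <⁺-below
  (run (m<m+n (suc j) (s≤s z≤n)) ≤-refl)
  (rightRun-sub w d (suc j) (subst (RightRun w (suc j)) (+-suc (suc j) d)
    (rightRun-shrink w j (m<m+n (suc j) (s≤s z≤n)) r)))
  (proj₂ (red-suc w (suc j)))

rightRun-reach : ∀ ls y rs → sub (#pos ls) y ≡ true →
  RightRun (ls ʳ++ y ∷ rs) (length ls) (suc (length ls) + reach _<ᵇ_ (#pos ls) y rs)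
rightRun-reach ls (suc y) rs e = go rs
  where
  stop : ∀ rs → RightRun (ls ʳ++ suc y ∷ rs) (length ls) (suc (length ls) + 0)
  stop rs rewrite +-identityʳ (length ls) =
    ≤-refl , (λ t< ≤t → ⊥-elim (<⇒≱ t< ≤t)) ,
    subst₂ (λ a r → a <⁺ [ r ]) (sym (letter-first ls (suc y ∷ rs))) (sym (red-first ls (suc y) rs))
      [ s≤s (true⇒< {y} e) ]
  go : ∀ rs → RightRun (ls ʳ++ suc y ∷ rs) (length ls)
                       (suc (length ls) + reach _<ᵇ_ (#pos ls) (suc y) rs)
  go [] = stop []
  go (z ∷ rs) with sub (suc (#pos ls)) z in e₁ | suc y <ᵇ z in e₂
  ... | true  | false = stop (z ∷ rs)
  ... | false | _     = stop (z ∷ rs)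
  ... | true  | true  = rightRun-extend w (length ls) rise
    (subst (RightRun w (suc (length ls))) (sym (+-suc (suc (length ls)) _))
      (rightRun-reach (suc y ∷ ls) z rs e₁))
    where
    w = ls ʳ++ suc y ∷ z ∷ rs
    rise : letter w (suc (length ls)) <⁺ letter w (suc (suc (length ls)))
    rise = subst₂ _<⁺_ (sym (letter-first ls (suc y ∷ z ∷ rs))) (sym (letter-second ls (suc y) (z ∷ rs)))
      [ true⇒< {suc y} {z} e₂ ]

-- An admissible end farther on makes the next letter subexcedent by `rightRun-sub`; hence the
-- letter-by-letter walk does not stop before it.
rightRun-≤-reach : ∀ ls y rs {k} → RightRun (ls ʳ++ suc y ∷ rs) (length ls) k →
  k ≤ suc (length ls) + reach _<ᵇ_ (#pos ls) (suc y) rs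
rightRun-≤-reach ls y rs {k} r@(j<k , run , _) with m≤n⇒m<n∨m≡n j<k
... | inj₂ refl = m≤m+n (suc (length ls)) _
... | inj₁ j<k′ = go rs r
  where
  go : ∀ rs → RightRun (ls ʳ++ suc y ∷ rs) (length ls) k →
       k ≤ suc (length ls) + reach _<ᵇ_ (#pos ls) (suc y) rs
  go rs r with rightRun-shrink (ls ʳ++ suc y ∷ rs) (length ls) j<k′ r
  ... | r′ with rightRun-sub (ls ʳ++ suc y ∷ rs) (k ∸ suc (suc (length ls))) (suc (length ls))
                  (subst (RightRun _ _) (sym (m+[n∸m]≡n j<k′)) r′)
              | proj₁ (proj₂ r) j<k′ ≤-refl
  ... | s | rise rewrite letter-first ls (suc y ∷ rs) | letter-second ls (suc y) rs = next rs s rise r′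
    where
    next : ∀ rs → letter rs 1 <⁺ [ red (ls ʳ++ suc y ∷ rs) (suc (suc (length ls))) ] →
      [ suc y ] <⁺ letter rs 1 → RightRun (ls ʳ++ suc y ∷ rs) (suc (length ls)) k →
      k ≤ suc (length ls) + reach _<ᵇ_ (#pos ls) (suc y) rs
    next []           ()
    next (zero ∷ rs)  s [ () ] r′
    next (suc z ∷ rs) s [ y<z ] r′
      rewrite red-first (suc y ∷ ls) (suc z) rs with [ z<p ] ← s
      rewrite <⇒true {z} {suc (#pos ls)} (s≤s⁻¹ z<p) | <⇒true {y} {z} (s≤s⁻¹ y<z)
      | +-suc (length ls) (reach _<ᵇ_ (suc (#pos ls)) (suc z) rs) =
      rightRun-≤-reach (suc y ∷ ls) z rs r′

rightEnd-plug : ∀ ls y rs → sub (#pos ls) y ≡ true →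
  rightEnd (plug (ls , y ∷ rs)) (suc (length ls)) ≡
  suc (suc (length ls)) + reach _<ᵇ_ (#pos ls) y rs
rightEnd-plug ls (suc y) rs e = max≈v⁺
  (∈-filter⁺ (rightRun? w j) (∈-positions w (letter-bound w _ (proj₂ (proj₂ r)))) r)
  -- The marked 0 is put into the prefix, where `#pos` does not see it.
  (All.map (rightRun-≤-reach (0 ∷ ls) y rs) (all-filter (rightRun? w j) (positions w)))
  (m≤m+n (suc j) _)
  where
  w = plug (ls , suc y ∷ rs)
  j = suc (length ls)
  r = rightRun-reach (0 ∷ ls) (suc y) rs e

moveRight-plug : ∀ ls rs r → moveRight (plug (ls , rs)) (suc (length ls)) (suc (suc (length ls)) + r) ≡
  ls ʳ++ insert0 (suc r) rs
moveRight-plug ls rs r = begin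
  take (length ls) w ++ drop (suc (length ls)) (take (suc (suc (length ls)) + r) w) ++ 0 ∷ drop (suc (suc (length ls)) + r) w
    ≡⟨ cong₂ (λ i k → take (length ls) w ++ drop i (take k w) ++ 0 ∷ drop k w) (+-comm 1 (length ls)) k-eq ⟩
  take (length ls) w ++ drop (length ls + 1) (take (length ls + (2 + r)) w) ++ 0 ∷ drop (length ls + (2 + r)) w
    ≡⟨ cong₂ (λ a b → a ++ drop (length ls + 1) b ++ 0 ∷ drop (length ls + (2 + r)) w)
         (take-length-ʳ++ ls (0 ∷ rs)) (take-ʳ++ ls (2 + r) (0 ∷ rs)) ⟩
  (ls ʳ++ []) ++ drop (length ls + 1) (ls ʳ++ 0 ∷ take (suc r) rs) ++ 0 ∷ drop (length ls + (2 + r)) w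
    ≡⟨ cong₂ (λ a b → (ls ʳ++ []) ++ a ++ 0 ∷ b)
         (drop-ʳ++ ls 1 (0 ∷ take (suc r) rs)) (drop-ʳ++ ls (2 + r) (0 ∷ rs)) ⟩
  (ls ʳ++ []) ++ insert0 (suc r) rs
    ≡⟨ ʳ++-[]-++ ls ⟩
  ls ʳ++ insert0 (suc r) rs ∎
  where
  open ≡-Reasoning
  w = plug (ls , rs)
  k-eq : suc (suc (length ls)) + r ≡ length ls + (2 + r)
  k-eq = trans (cong (_+ r) (+-comm 2 (length ls))) (+-assoc (length ls) 2 r)

leftRun-extend : ∀ w e {i} → letter w (suc e) <⁺ letter w e →
  LeftRun w (suc e) i → LeftRun w (suc (suc e)) i
leftRun-extend w e {i} fall (i≤e , run , end) = ≤-trans i≤e (n≤1+n _) , run′ , end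
  where
  run′ : ∀ {t} → t < suc e → i ≤ t → letter w (suc t) <⁺ letter w t
  run′ t<e i≤t with m≤n⇒m<n∨m≡n (s≤s⁻¹ t<e)
  ... | inj₁ t<e′ = run t<e′ i≤t
  ... | inj₂ refl = fall

leftRun-shrink : ∀ w e {i} → i < suc e → LeftRun w (suc (suc e)) i → LeftRun w (suc e) i
leftRun-shrink w e i<e (_ , run , end) = s≤s⁻¹ i<e , (λ t<e → run (≤-trans t<e (n≤1+n _))) , end

-- Here subexcedence propagates forwards: the letters fall and `red` never decreases.
leftRun-sub : ∀ w e i → LeftRun w (suc e) i → letter w e <⁺ [ red w e ]
leftRun-sub w e i r@(i≤e , run , end) with m≤n⇒m<n∨m≡n i≤e
... | inj₂ refl = end
leftRun-sub w (suc e) i r@(i≤e , run , end) | inj₁ i<e = <⁺-≤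
  (<⁺-trans <-trans (run (n<1+n _) (s≤s⁻¹ i<e)) (leftRun-sub w e i (leftRun-shrink w e i<e r)))
  (proj₁ (red-suc w e))

-- The length of the left component of runL lt x ls rs.
leftover : Order → ℕ → Word → ℕ
leftover lt x []       = 0
leftover lt x (y ∷ ls) = if sub (#pos ls) y ∧ lt x y then leftover lt y ls else suc (length ls)

leftRun-stop : ∀ x ls ys → sub (#pos ls) (suc x) ≡ true →
  LeftRun (ls ʳ++ suc x ∷ ys) (suc (suc (length ls))) (suc (length ls))
leftRun-stop x ls ys e = ≤-refl , (λ t< ≤t → ⊥-elim (<⇒≱ t< ≤t)) ,
  subst₂ (λ a r → a <⁺ [ r ]) (sym (letter-first ls (suc x ∷ ys)))
    (sym (red-first ls (suc x) ys)) [ s≤s (true⇒< {x} e) ]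

leftRun-leftover : ∀ x ls ys → sub (#pos ls) x ≡ true →
  LeftRun (ls ʳ++ x ∷ ys) (suc (suc (length ls))) (suc (leftover _<ᵇ_ x ls))
leftRun-leftover x [] ys e with () ← trans (sym e) (sub-zero x)
leftRun-leftover (suc x) (y ∷ ls) ys e with sub (#pos ls) y in e₁ | suc x <ᵇ y in e₂
... | true  | true  = leftRun-extend ((y ∷ ls) ʳ++ suc x ∷ ys) (suc (length ls)) fall
                        (leftRun-leftover y ls (suc x ∷ ys) e₁)
  where
  fall : letter ((y ∷ ls) ʳ++ suc x ∷ ys) (suc (suc (length ls))) <⁺
         letter ((y ∷ ls) ʳ++ suc x ∷ ys) (suc (length ls))
  fall = subst₂ _<⁺_ (sym (letter-second ls y (suc x ∷ ys))) (sym (letter-first ls (y ∷ suc x ∷ ys)))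
    [ true⇒< {suc x} {y} e₂ ]
... | true  | false = leftRun-stop x (y ∷ ls) ys e
... | false | _     = leftRun-stop x (y ∷ ls) ys e

leftover-≤-leftRun : ∀ x ls ys {i} → LeftRun (ls ʳ++ suc x ∷ ys) (suc (suc (length ls))) (suc i) →
  leftover _<ᵇ_ (suc x) ls ≤ i
leftover-≤-leftRun x []       ys r = z≤n
leftover-≤-leftRun x (y ∷ ls) ys {i} r@(i≤ , run , _) with m≤n⇒m<n∨m≡n i≤
... | inj₂ refl with sub (#pos ls) y ∧ (suc x <ᵇ y)
...   | true  = ≤-trans (leftover-≤ y ls) (n≤1+n _)
  where
  leftover-≤ : ∀ y ls → leftover _<ᵇ_ y ls ≤ length ls
  leftover-≤ y []       = z≤n
  leftover-≤ y (z ∷ ls) with sub (#pos ls) z ∧ (y <ᵇ z)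
  ... | true  = ≤-trans (leftover-≤ z ls) (n≤1+n _)
  ... | false = ≤-refl
...   | false = ≤-refl
leftover-≤-leftRun x (y ∷ ls) ys {i} r@(i≤ , run , _) | inj₁ i<
  with leftRun-shrink ((y ∷ ls) ʳ++ suc x ∷ ys) (suc (length ls)) i< r
... | r′ with leftRun-sub ((y ∷ ls) ʳ++ suc x ∷ ys) (suc (length ls)) (suc i) r′
            | run ≤-refl (s≤s⁻¹ i<)
... | s | fall
  rewrite letter-second ls y (suc x ∷ ys) | letter-first ls (y ∷ suc x ∷ ys)
        | red-first ls y (suc x ∷ ys)
  = next y s fall r′
  where
  next : ∀ y → [ y ] <⁺ [ #pos (y ∷ ls) ] → [ suc x ] <⁺ [ y ] →
         LeftRun (ls ʳ++ y ∷ suc x ∷ ys) (suc (suc (length ls))) (suc i) →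
         leftover _<ᵇ_ (suc x) (y ∷ ls) ≤ i
  next zero    s [ () ] r′
  next (suc y) [ y<p ] [ x<y ] r′
    rewrite <⇒true {y} {#pos ls} (s≤s⁻¹ y<p) | <⇒true {x} {y} (s≤s⁻¹ x<y) =
    leftover-≤-leftRun y ls (suc x ∷ ys) r′

leftEnd-plug : ∀ x ls rs → sub (#pos ls) x ≡ true →
  leftEnd (plug (x ∷ ls , rs)) (suc (suc (length ls))) ≡ suc (leftover _<ᵇ_ x ls)
leftEnd-plug (suc x) ls rs e = min≈v⁺
  (∈-filter⁺ (leftRun? w j) (∈-positions w (letter-bound w _ (proj₂ (proj₂ r)))) r)
  (All.map (λ {i} → bound i) (all-filter (leftRun? w j) (positions w)))
  (proj₁ r)
  where
  w = plug (suc x ∷ ls , rs)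
  j = suc (suc (length ls))
  r = leftRun-leftover (suc x) ls (0 ∷ rs) e
  bound : ∀ i → LeftRun w j i → suc (leftover _<ᵇ_ (suc x) ls) ≤ i
  -- Position 0 carries +∞, so no left run starts there.
  bound zero    (_ , _ , ())
  bound (suc i) r = s≤s (leftover-≤-leftRun x ls (0 ∷ rs) r)

-- `xs` collects the letters already jumped, in reading order.
moveLeft-runL : ∀ x ls xs rs →
  take (leftover _<ᵇ_ x ls) (ls ʳ++ x ∷ xs ++ 0 ∷ rs) ++
    0 ∷ drop (leftover _<ᵇ_ x ls) (ls ʳ++ x ∷ xs) ++ rs ≡
  plug (runL _<ᵇ_ x ls (xs ++ rs))
moveLeft-runL x []       xs rs = refl
moveLeft-runL x (y ∷ ls) xs rs with sub (#pos ls) y ∧ (x <ᵇ y)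
... | true  = moveLeft-runL y ls (x ∷ xs) rs
... | false
  rewrite take-length-ʳ++ (y ∷ ls) (x ∷ xs ++ 0 ∷ rs) | drop-length-ʳ++ (y ∷ ls) (x ∷ xs) =
  ʳ++-[]-++ (y ∷ ls)

moveLeft-plug : ∀ x ls rs →
  moveLeft (plug (x ∷ ls , rs)) (suc (suc (length ls))) (suc (leftover _<ᵇ_ x ls)) ≡
  plug (runL _<ᵇ_ x ls rs)
moveLeft-plug x ls rs
  rewrite take-length-ʳ++ (x ∷ ls) (0 ∷ rs) | +-comm 1 (length ls) | sym (+-suc (length ls) 1)
        | drop-ʳ++ ls 2 (x ∷ 0 ∷ rs) = moveLeft-runL x ls [] rs

moveZero-plug : ∀ ls rs → Good (letters ls rs) →
  moveZero (plug (ls , rs)) (suc (length ls)) ≡ plug (move _<ᵇ_ ls rs)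
moveZero-plug ls rs g
  rewrite does-movesRight ls rs g | does-movesLeft ls rs g
  with rightward _<ᵇ_ ls rs in r | leftward _<ᵇ_ ls rs in l
moveZero-plug ls (y ∷ rs) g | true | _
  rewrite rightEnd-plug ls y rs (rightward⇒sub _<ᵇ_ ls y rs r)
        | moveRight-plug ls (y ∷ rs) (reach _<ᵇ_ (#pos ls) y rs) =
  sym (plug-runR _<ᵇ_ y ls rs (rightward⇒sub _<ᵇ_ ls y rs r))
moveZero-plug (x ∷ ls) rs g | false | true
  rewrite leftEnd-plug x ls rs (leftward⇒sub _<ᵇ_ x ls rs l) = moveLeft-plug x ls rs
moveZero-plug ls rs g | false | false = refl

-- The maps `φ` as moves of the zero of a given rank

zeroPositionsFrom : ℕ → Word → List ℕ
zeroPositionsFrom n []          = []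
zeroPositionsFrom n (zero ∷ w)  = suc n ∷ zeroPositionsFrom (suc n) w
zeroPositionsFrom n (suc x ∷ w) = zeroPositionsFrom (suc n) w

zeroPositions-from : ∀ w → zeroPositions w ≡ zeroPositionsFrom 0 w
zeroPositions-from w = go suc [] w (λ _ → refl)
  where
  go : ∀ f ls ys → (∀ i → f i ≡ suc (length ls + i)) →
    filter (λ i → letter (ls ʳ++ ys) i ≟⁺ [ 0 ]) (applyUpTo f (length ys)) ≡
    zeroPositionsFrom (length ls) ys
  go f ls []          eq = refl
  go f ls (y ∷ ys)    eq with IH ← go (f ∘ suc) (y ∷ ls) ys (λ i → trans (eq (suc i)) (cong suc (+-suc (length ls) i)))
    with f 0 | trans (eq 0) (cong suc (+-identityʳ (length ls)))
  go f ls (zero ∷ ys)  eq | _ | refl rewrite letter-first ls (0 ∷ ys) = cong (suc (length ls) ∷_) IH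
  go f ls (suc y ∷ ys) eq | _ | refl rewrite letter-first ls (suc y ∷ ys) = IH

-- Here `l` is the number of zeros to the left of the one sought, which belongs to level `suc l`.
data Locate (l : ℕ) (w : Word) : Set where
  missing : #zero w ≤ l → letter (zeroPositionsFrom 0 w) (suc l) ≡ ⊤⁺ → Locate l w
  found   : ∀ ls rs → w ≡ plug (ls , rs) → #zero ls ≡ l →
            letter (zeroPositionsFrom 0 w) (suc l) ≡ [ suc (length ls) ] → Locate l w

locate : ∀ l w → Locate l w
locate l w = go l [] w refl refl
  where
  go : ∀ k ls ys → #zero ls + k ≡ l →
    letter (zeroPositionsFrom 0 (ls ʳ++ ys)) (suc l) ≡ letter (zeroPositionsFrom (length ls) ys) (suc k) →
    Locate l (ls ʳ++ ys)
  go k ls [] refl e = missing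
    (subst (_≤ #zero ls + k) (sym (trans (#zero-ʳ++ ls []) (+-identityʳ (#zero ls)))) (m≤m+n (#zero ls) k)) e
  go zero    ls (zero ∷ ys)  eq e = found ls ys refl (trans (sym (+-identityʳ _)) eq) e
  go (suc k) ls (zero ∷ ys)  eq e = go k (0 ∷ ls) ys (trans (sym (+-suc _ k)) eq) e
  go k       ls (suc y ∷ ys) eq e = go k (suc y ∷ ls) ys eq e

-- With `_<ᵇ_` this is `φ (suc l)`; the order is left free so that its opposite gives the inverse.
shift : Order → ℕ → Word → Word → Word
shift lt l       ls []           = ls ʳ++ []
shift lt l       ls (suc y ∷ rs) = shift lt l (suc y ∷ ls) rs
shift lt zero    ls (zero ∷ rs)  = plug (move lt ls rs)
shift lt (suc l) ls (zero ∷ rs)  = shift lt l (0 ∷ ls) rs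

shift-ʳ++ : ∀ lt ls l rs → shift lt (#zero ls + l) [] (ls ʳ++ rs) ≡ shift lt l ls rs
shift-ʳ++ lt []           l rs = refl
shift-ʳ++ lt (zero ∷ ls)  l rs rewrite sym (+-suc (#zero ls) l) = shift-ʳ++ lt ls (suc l) (0 ∷ rs)
shift-ʳ++ lt (suc x ∷ ls) l rs = shift-ʳ++ lt ls l (suc x ∷ rs)

shift-plug : ∀ lt ls rs → shift lt (#zero ls) [] (plug (ls , rs)) ≡ plug (move lt ls rs)
shift-plug lt ls rs = trans
  (cong (λ l → shift lt l [] (plug (ls , rs))) (sym (+-identityʳ (#zero ls)))) (shift-ʳ++ lt ls 0 (0 ∷ rs))

shift-missing : ∀ lt l ls rs → #zero rs ≤ l → shift lt l ls rs ≡ ls ʳ++ rs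
shift-missing lt l       ls []           _ = refl
shift-missing lt (suc l) ls (zero ∷ rs)  (s≤s b) = shift-missing lt l (0 ∷ ls) rs b
shift-missing lt l       ls (suc y ∷ rs) b = shift-missing lt l (suc y ∷ ls) rs b

φ-shift : ∀ l w → Good (Pos w) → φ (suc l) w ≡ shift _<ᵇ_ l [] w
φ-shift l w g with locate l w
... | missing b e rewrite zeroPositions-from w | e = sym (shift-missing _<ᵇ_ l [] w b)
... | found ls rs refl refl e rewrite zeroPositions-from w | e =
  trans (moveZero-plug ls rs (subst Good (Pos-ʳ++ ls (0 ∷ rs)) g)) (sym (shift-plug _<ᵇ_ ls rs))

length-#pos-#zero : ∀ w → length w ≡ #pos w + #zero w
length-#pos-#zero []          = refl
length-#pos-#zero (zero ∷ w)  = trans (cong suc (length-#pos-#zero w)) (sym (+-suc (#pos w) (#zero w)))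
length-#pos-#zero (suc x ∷ w) = cong suc (length-#pos-#zero w)

≈z-Pos : ∀ y z → y ≈z z → Pos (plug y) ≡ Pos (plug z)
≈z-Pos (ls , rs) (ls′ , rs′) (_ , _ , e) =
  trans (Pos-ʳ++ ls (0 ∷ rs)) (trans e (sym (Pos-ʳ++ ls′ (0 ∷ rs′))))

≈z-#zero : ∀ y z → y ≈z z → #zero (plug y) ≡ #zero (plug z)
≈z-#zero (ls , rs) (ls′ , rs′) (e , e′ , _) = trans (#zero-ʳ++ ls (0 ∷ rs))
  (trans (cong₂ (λ a b → a + suc b) e e′) (sym (#zero-ʳ++ ls′ (0 ∷ rs′))))

module _ {lt : Order} (st : StrictTotal lt) (l : ℕ) where

  shift-Pos : ∀ w → Good (Pos w) → Pos (shift lt l [] w) ≡ Pos w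
  shift-Pos w g with locate l w
  ... | missing b _ = cong Pos (shift-missing lt l [] w b)
  ... | found ls rs refl refl _ rewrite shift-plug lt ls rs =
    ≈z-Pos (move lt ls rs) (ls , rs) (move-≈ st ls rs (subst Good (Pos-ʳ++ ls (0 ∷ rs)) g))

  shift-#zero : ∀ w → Good (Pos w) → #zero (shift lt l [] w) ≡ #zero w
  shift-#zero w g with locate l w
  ... | missing b _ = cong #zero (shift-missing lt l [] w b)
  ... | found ls rs refl refl _ rewrite shift-plug lt ls rs =
    ≈z-#zero (move lt ls rs) (ls , rs) (move-≈ st ls rs (subst Good (Pos-ʳ++ ls (0 ∷ rs)) g))

  -- The moving 0 crosses no other 0, so the same `l` finds it again, and `move-flip` brings it
  -- back.
  shift-flip : ∀ w → Good (Pos w) → shift (flip lt) l [] (shift lt l [] w) ≡ w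
  shift-flip w g with locate l w
  ... | missing b _ rewrite shift-missing lt l [] w b = shift-missing (flip lt) l [] w b
  ... | found ls rs refl refl _ rewrite shift-plug lt ls rs
    with move lt ls rs | move-≈ st ls rs g′ | move-flip st ls rs g′
    where g′ = subst Good (Pos-ʳ++ ls (0 ∷ rs)) g
  ... | ls′ , rs′ | e , _ | back = begin
    shift (flip lt) (#zero ls) [] (plug (ls′ , rs′))   ≡⟨ cong (λ k → shift (flip lt) k [] (plug (ls′ , rs′))) (sym e) ⟩
    shift (flip lt) (#zero ls′) [] (plug (ls′ , rs′))  ≡⟨ shift-plug (flip lt) ls′ rs′ ⟩
    plug (move (flip lt) ls′ rs′)                      ≡⟨ cong plug back ⟩
    plug (ls , rs)                                     ∎
    where open ≡-Reasoning

marks-shift : ∀ l w → Good (Pos w) → marks (suc l) 0 w ≡ marks l 0 (shift _<ᵇ_ l [] w)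
marks-shift l w g with locate l w
... | missing b _ rewrite shift-missing _<ᵇ_ l [] w b = marks-saturated l 0 w b
... | found ls rs refl refl _ rewrite shift-plug _<ᵇ_ ls rs =
  marks-move ls rs (subst Good (Pos-ʳ++ ls (0 ∷ rs)) g)

-- Composition of all levels

module _ {A : Set} {S : Pred A 0ℓ} {f : ℕ → A → A} (f-closed : ∀ k x → x ∈ S → f k x ∈ S) where

  foldr-closed : ∀ ks x → x ∈ S → foldr f x ks ∈ S
  foldr-closed []       x x∈ = x∈
  foldr-closed (k ∷ ks) x x∈ = f-closed k _ (foldr-closed ks x x∈)

  foldl-closed : ∀ ks x → x ∈ S → foldl (flip f) x ks ∈ S
  foldl-closed []       x x∈ = x∈
  foldl-closed (k ∷ ks) x x∈ = foldl-closed ks (f k x) (f-closed k x x∈)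

  -- The outermost map must be undone first; `foldr` applies the head of the list last, so the
  -- inverse is a `foldl` over the same list.
  foldl∘foldr : ∀ {g} → (∀ k x → x ∈ S → g k (f k x) ≡ x) →
    ∀ ks x → x ∈ S → foldl (flip g) (foldr f x ks) ks ≡ x
  foldl∘foldr gf []       x x∈ = refl
  foldl∘foldr {g} gf (k ∷ ks) x x∈ =
    trans (cong (λ y → foldl (flip g) y ks) (gf k _ (foldr-closed ks x x∈))) (foldl∘foldr gf ks x x∈)

  foldr∘foldl : ∀ {g} → (∀ k x → x ∈ S → g k (f k x) ≡ x) →
    ∀ ks x → x ∈ S → foldr g (foldl (flip f) x ks) ks ≡ x
  foldr∘foldl gf []       x x∈ = refl
  foldr∘foldl {g} gf (k ∷ ks) x x∈ =
    trans (cong (g k) (foldr∘foldl gf ks (f k x) (f-closed k x x∈))) (gf k x x∈)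

-- The inverse of `φ` at each level; `φ 0` is the identity because index 0 carries +∞.
ψ : ℕ → Word → Word
ψ zero    w = w
ψ (suc l) w = shift (flip _<ᵇ_) l [] w

module _ {v : Word} (good : Good v) where

  private
    good-Pos : ∀ w → Pos w ≡ v → Good (Pos w)
    good-Pos w refl = good

    _∼_ : Word → Word → Set
    u ∼ w = Pos u ≡ Pos w × #zero u ≡ #zero w

    ∼-Sh : ∀ {n} u w → u ∼ w → w ∈ Sh n v → u ∈ Sh n v
    ∼-Sh u w (p , z) (len , zer , pos) =
      trans (length-#pos-#zero u) (trans (cong₂ _+_ (cong length p) z) (trans (sym (length-#pos-#zero w)) len)) ,
      trans z zer , trans p pos

  module _ {n : ℕ} where

    φ-closed : ∀ l w → w ∈ Sh n v → φ l w ∈ Sh n v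
    φ-closed zero    w w∈ = w∈
    φ-closed (suc l) w w∈@(_ , _ , pos) rewrite φ-shift l w (good-Pos w pos) =
      ∼-Sh (shift _<ᵇ_ l [] w) w (shift-Pos <ᵇ-strictTotal l w (good-Pos w pos) , shift-#zero <ᵇ-strictTotal l w (good-Pos w pos)) w∈

    ψ-closed : ∀ l w → w ∈ Sh n v → ψ l w ∈ Sh n v
    ψ-closed zero    w w∈ = w∈
    ψ-closed (suc l) w w∈@(_ , _ , pos) =
      ∼-Sh (ψ (suc l) w) w (shift-Pos st l w (good-Pos w pos) , shift-#zero st l w (good-Pos w pos)) w∈
      where st = flip-total <ᵇ-strictTotal

    ψ∘φ : ∀ l w → w ∈ Sh n v → ψ l (φ l w) ≡ w
    ψ∘φ zero    w w∈ = refl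
    ψ∘φ (suc l) w (_ , _ , pos) rewrite φ-shift l w (good-Pos w pos) =
      shift-flip <ᵇ-strictTotal l w (good-Pos w pos)

    φ∘ψ : ∀ l w → w ∈ Sh n v → φ l (ψ l w) ≡ w
    φ∘ψ zero    w w∈ = refl
    φ∘ψ (suc l) w w∈@(_ , _ , pos)
      rewrite φ-shift l (ψ (suc l) w) (good-Pos (ψ (suc l) w) (proj₂ (proj₂ (ψ-closed (suc l) w w∈)))) =
      shift-flip (flip-total <ᵇ-strictTotal) l w (good-Pos w pos)

    Φ-levels : ∀ w → w ∈ Sh n v → Φ w ≡ foldr φ w (applyUpTo suc n)
    Φ-levels w (refl , _) = refl

    Φ-closed : ∀ w → w ∈ Sh n v → Φ w ∈ Sh n v
    Φ-closed w w∈ = subst (_∈ Sh n v) (sym (Φ-levels w w∈))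
      (foldr-closed {f = φ} φ-closed (applyUpTo suc n) w w∈)

    Φ-bijection : BijectionOnto (Sh n v) Φ
    Φ-bijection = (λ {w} → Φ-closed w) , (λ {x y} → injective {x} {y}) , surjective
      where
      levels = applyUpTo suc n
      injective : ∀ {x y : Σ Word (Sh n v)} → Φ (proj₁ x) ≡ Φ (proj₁ y) → proj₁ x ≡ proj₁ y
      injective {x , x∈} {y , y∈} e = begin
        x                                          ≡⟨ sym (foldl∘foldr {f = φ} φ-closed {ψ} ψ∘φ levels x x∈) ⟩
        foldl (flip ψ) (foldr φ x levels) levels   ≡⟨ cong (λ u → foldl (flip ψ) u levels) e′ ⟩
        foldl (flip ψ) (foldr φ y levels) levels   ≡⟨ foldl∘foldr {f = φ} φ-closed {ψ} ψ∘φ levels y y∈ ⟩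
        y                                          ∎
        where
        open ≡-Reasoning
        e′ = trans (sym (Φ-levels x x∈)) (trans e (Φ-levels y y∈))
      surjective : ∀ (y : Σ Word (Sh n v)) → ∃ λ (x : Σ Word (Sh n v)) →
        ∀ {z : Σ Word (Sh n v)} → proj₁ z ≡ proj₁ x → Φ (proj₁ z) ≡ proj₁ y
      surjective (y , y∈) = (foldl (flip ψ) y levels , foldl-closed {f = ψ} ψ-closed levels y y∈) ,
        λ { {z , z∈} refl → trans (Φ-levels z z∈) (foldr∘foldl {f = ψ} ψ-closed {φ} φ∘ψ levels y y∈) }

    marks-Φ : ∀ w → w ∈ Sh n v → marks n 0 w ≡ marks 0 0 (Φ w)
    marks-Φ w w∈ = trans (go 0 n refl suc (λ _ → refl)) (cong (marks 0 0) (sym (Φ-levels w w∈)))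
      where
      -- After levels `n` down to `suc k`, listed by `f`, only the first `k` zeros still obey RISE.
      go : ∀ k d → k + d ≡ n → ∀ f → (∀ i → f i ≡ suc (k + i)) →
           marks n 0 w ≡ marks k 0 (foldr φ w (applyUpTo f d))
      go k zero    eq f _ rewrite sym eq | +-identityʳ k = refl
      go k (suc d) eq f f≡ = begin
        marks n 0 w                    ≡⟨ go (suc k) d (trans (sym (+-suc k d)) eq) (f ∘ suc)
                                            (λ i → trans (f≡ (suc i)) (cong suc (+-suc k i))) ⟩
        marks (suc k) 0 u              ≡⟨ marks-shift k u (good-Pos u pos) ⟩
        marks k 0 (shift _<ᵇ_ k [] u)  ≡⟨ cong (marks k 0) (sym (φ-shift k u (good-Pos u pos))) ⟩
        marks k 0 (φ (suc k) u)        ≡⟨ cong (λ l → marks k 0 (φ l u))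
                                            (sym (trans (f≡ 0) (cong suc (+-identityʳ k)))) ⟩
        marks k 0 (φ (f 0) u)          ∎
        where
        open ≡-Reasoning
        u = foldr φ w (applyUpTo (f ∘ suc) d)
        pos : Pos u ≡ v
        pos = proj₂ (proj₂ (foldr-closed {f = φ} φ-closed (applyUpTo (f ∘ suc) d) w w∈))

-- RISE and RISE• as sets of marked positions

Marked : List Bool → ℕ → Set
Marked []       i             = ⊥
Marked (b ∷ bs) zero          = ⊥
Marked (b ∷ bs) (suc zero)    = T b
Marked (b ∷ bs) (suc (suc i)) = Marked bs (suc i)

-- Each 0 of the prefix uses up one level; the truncation of `_∸_` is that of `pred` in `marks`.
Marked-ʳ++ : ∀ l ls i ys → Marked (marks l 0 (ls ʳ++ ys)) (suc (length ls + i)) ≡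
                           Marked (marks (l ∸ #zero ls) (#pos ls) ys) (suc i)
Marked-ʳ++ l []           i ys = refl
Marked-ʳ++ l (zero ∷ ls)  i ys
  rewrite sym (+-suc (length ls) i) | Marked-ʳ++ l ls (suc i) (0 ∷ ys) | pred[m∸n]≡m∸[1+n] l (#zero ls) = refl
Marked-ʳ++ l (suc x ∷ ls) i ys
  rewrite sym (+-suc (length ls) i) = Marked-ʳ++ l ls (suc i) (suc x ∷ ys)

Marked-first : ∀ l ls ys → Marked (marks l 0 (ls ʳ++ ys)) (suc (length ls)) ≡
                           Marked (marks (l ∸ #zero ls) (#pos ls) ys) 1
Marked-first l ls ys rewrite sym (Marked-ʳ++ l ls 0 ys) | +-identityʳ (length ls) = refl

data At (w : Word) : ℕ → Set where
  at : ∀ ls x rs → w ≡ ls ʳ++ x ∷ rs → At w (suc (length ls))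

at? : ∀ w i → 1 ≤ i × i ≤ length w → At w i
at? w (suc i) (_ , i<) = subst (λ k → At w (suc k)) (+-identityʳ i) (go [] w i i<)
  where
  go : ∀ ls ys i → suc i ≤ length ys → At (ls ʳ++ ys) (suc (i + length ls))
  go ls (y ∷ ys) zero    _         = at ls y ys refl
  go ls (y ∷ ys) (suc i) (s≤s i<) =
    subst (λ k → At (ls ʳ++ y ∷ ys) (suc k)) (+-suc i (length ls)) (go (y ∷ ls) ys i i<)

Marked-bound : ∀ bs i → Marked bs i → 1 ≤ i × i ≤ length bs
Marked-bound (b ∷ bs) (suc zero)    m = s≤s z≤n , s≤s z≤n
Marked-bound (b ∷ bs) (suc (suc i)) m = s≤s z≤n , s≤s (proj₂ (Marked-bound bs (suc i) m))

length-marks : ∀ l p w → length (marks l p w) ≡ length w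
length-marks l p []          = refl
length-marks l p (zero ∷ w)  = cong suc (length-marks (pred l) p w)
length-marks l p (suc x ∷ w) = cong suc (length-marks l (suc p) w)

Marked-marks-bound : ∀ l w i → Marked (marks l 0 w) i → 1 ≤ i × i ≤ length w
Marked-marks-bound l w i m with Marked-bound (marks l 0 w) i m
... | b rewrite length-marks l 0 w = b

rise⇔marked : ∀ k ls x rs → Good (letters ls (x ∷ rs)) → #zero (x ∷ rs) ≤ k →
  [ x ] ≤⁺ letter rs 1 ⇔ Marked (marks k (#pos ls) (x ∷ rs)) 1
rise⇔marked k ls x rs g b = mk⇔ (to k x rs g b) (from k x rs b)
  where
  to : ∀ k x rs → Good (letters ls (x ∷ rs)) → #zero (x ∷ rs) ≤ k →
    [ x ] ≤⁺ letter rs 1 → Marked (marks k (#pos ls) (x ∷ rs)) 1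
  to (suc k) zero    rs           g b _ = tt
  to k       (suc x) []           g b _ = tt
  to (suc k) (suc x) (zero ∷ rs)  g b [ () ]
  -- Distinct neighbours turn the weak inequality of RISE into the strict one of `marks`.
  to k       (suc x) (suc y ∷ rs) g b [ x≤y ] = <⇒<ᵇ (≤∧≢⇒< x≤y (adjacent ls rs g))
  from : ∀ k x rs → #zero (x ∷ rs) ≤ k →
    Marked (marks k (#pos ls) (x ∷ rs)) 1 → [ x ] ≤⁺ letter rs 1
  from k       zero    []           b _ = _ ≤⊤⁺
  from k       zero    (y ∷ rs)     b _ = [ z≤n ]
  from k       (suc x) []           b _ = _ ≤⊤⁺
  from (suc k) (suc x) (zero ∷ rs)  b ()
  from k       (suc x) (suc y ∷ rs) b m = [ <⇒≤ (<ᵇ⇒< (suc x) (suc y) m) ]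

BulletRise : ℕ ⁺ → ℕ → ℕ ⁺ → ℕ → Set
BulletRise a r b s =
  ([ 0 ] <⁺ a × a <⁺ b)
  ⊎ (a ≡ [ 0 ] × b ≡ [ 0 ])
  ⊎ (a ≡ [ 0 ] × ([ 0 ] <⁺ b × [ s ] <⁺ b))
  ⊎ (([ 0 ] <⁺ a × a <⁺ [ r ]) × b ≡ [ 0 ])

bulletRise⇔marked : ∀ ls x rs → Good (letters ls (x ∷ rs)) →
  BulletRise [ x ] (#pos (x ∷ ls)) (letter rs 1) (#pos (x ∷ ls) + #pos (take 1 rs)) ⇔
  Marked (marks 0 (#pos ls) (x ∷ rs)) 1
bulletRise⇔marked ls zero [] g = mk⇔ (λ _ → tt) (λ _ → inj₂ (inj₂ (inj₁ (refl , [ _ ]<⊤⁺ , [ _ ]<⊤⁺))))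
bulletRise⇔marked ls zero (zero ∷ rs) g = mk⇔ (λ _ → tt) (λ _ → inj₂ (inj₁ (refl , refl)))
bulletRise⇔marked ls zero (suc y ∷ rs) (_ , nf) rewrite +-comm (#pos ls) 1 with y <ᵇ #pos ls in e
... | true  = mk⇔
  (λ { (inj₁ ([ () ] , _)) ; (inj₂ (inj₁ (_ , ())))
     ; (inj₂ (inj₂ (inj₁ (_ , _ , [ p<y ])))) → <-asym (s≤s⁻¹ p<y) (true⇒< {y} e)
     ; (inj₂ (inj₂ (inj₂ (_ , ())))) })
  (λ ())
-- Only `#pos ls ≤ y` is known at first; as no letter is fixed, the inequality is strict and the
-- letter is excedent.
... | false = mk⇔ (λ _ → tt) λ _ → inj₂ (inj₂ (inj₁ (refl , [ s≤s z≤n ] ,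
  [ s≤s (≤∧≢⇒< (false⇒≥ {y} e) (nofix ls rs nf ∘ sym)) ])))
bulletRise⇔marked ls (suc x) [] g = mk⇔ (λ _ → tt) (λ _ → inj₁ ([ s≤s z≤n ] , [ _ ]<⊤⁺))
bulletRise⇔marked ls (suc x) (zero ∷ rs) g = mk⇔
  (λ { (inj₁ (_ , [ () ])) ; (inj₂ (inj₁ (() , _))) ; (inj₂ (inj₂ (inj₁ (() , _))))
     ; (inj₂ (inj₂ (inj₂ ((_ , [ x<p ]) , _)))) → <⇒<ᵇ (s≤s⁻¹ x<p) })
  (λ m → inj₂ (inj₂ (inj₂ (([ s≤s z≤n ] , [ s≤s (<ᵇ⇒< x _ m) ]) , refl))))
bulletRise⇔marked ls (suc x) (suc y ∷ rs) g = mk⇔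
  (λ { (inj₁ (_ , [ x<y ])) → <⇒<ᵇ x<y ; (inj₂ (inj₁ (() , _))) ; (inj₂ (inj₂ (inj₁ (() , _))))
     ; (inj₂ (inj₂ (inj₂ (_ , ())))) })
  (λ m → inj₁ ([ s≤s z≤n ] , [ <ᵇ⇒< (suc x) (suc y) m ]))

RISE-marks : ∀ l w → Good (Pos w) → #zero w ≤ l → RISE w ≐ Marked (marks l 0 w)
RISE-marks l w g b =
  (λ {i} (bd , rise) → Equivalence.to (local i bd) rise) ,
  (λ {i} m → let bd = Marked-marks-bound l w i m in bd , Equivalence.from (local i bd) m)
  where
  local : ∀ i → 1 ≤ i × i ≤ length w → letter w i ≤⁺ letter w (suc i) ⇔ Marked (marks l 0 w) i
  local i bd with at? w i bd
  ... | at ls x rs refl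
    rewrite letter-first ls (x ∷ rs) | letter-second ls x rs | Marked-first l ls (x ∷ rs) =
    rise⇔marked (l ∸ #zero ls) ls x rs (subst Good (Pos-ʳ++ ls (x ∷ rs)) g)
      (m+n≤o⇒m≤o∸n (#zero (x ∷ rs)) (subst (_≤ l) (trans (#zero-ʳ++ ls (x ∷ rs)) (+-comm (#zero ls) _)) b))

RISE•-marks : ∀ w → Good (Pos w) → RISE• w ≐ Marked (marks 0 0 w)
RISE•-marks w g =
  (λ {i} (bd , rise) → Equivalence.to (local i bd) rise) ,
  (λ {i} m → let bd = Marked-marks-bound 0 w i m in bd , Equivalence.from (local i bd) m)
  where
  local : ∀ i → 1 ≤ i × i ≤ length w →
    BulletRise (letter w i) (red w i) (letter w (suc i)) (red w (suc i)) ⇔ Marked (marks 0 0 w) i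
  local i bd with at? w i bd
  ... | at ls x rs refl
    rewrite letter-first ls (x ∷ rs) | letter-second ls x rs | Marked-first 0 ls (x ∷ rs)
          | 0∸n≡0 (#zero ls) | red-first ls x rs
          | trans (cong (red (ls ʳ++ x ∷ rs)) (+-comm 1 (suc (length ls)))) (red-ʳ++ (x ∷ ls) 1 rs) =
    bulletRise⇔marked ls x rs (subst Good (Pos-ʳ++ ls (x ∷ rs)) g)

derangement⇒good : ∀ {m v} → v ∈ Derangement m → Good v
derangement⇒good {m} {v} (perm , nf) =
  Unique-resp-↭ (setoid ℕ) (↭⇒↭ₛ (↭-sym perm)) (applyUpTo⁺₁ suc m (λ i<j _ → <⇒≢ (s≤s i<j))) , nofix-all
  where
  letter-≤ : ∀ w i {x} → letter w i ≡ [ x ] → 1 ≤ i × i ≤ length w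
  letter-≤ w i {x} e = letter-bound w i (subst (_<⁺ ⊤⁺) (sym e) [ x ]<⊤⁺)
  nofix-all : NoFix v
  -- An index carrying a finite letter lies between 1 and `m`, so `nf` applies to it.
  nofix-all i e with 1≤i , i≤ ← letter-≤ v i e =
    nf i 1≤i (≤-trans i≤ (≤-reflexive (trans (↭-length perm) (length-applyUpTo suc m)))) e

theorem1p1 : ∀ (m : ℕ) (v : Word) → v ∈ Derangement m → ∀ (n : ℕ) → m ≤ n →
    BijectionOnto (Sh n v) Φ ×
    (∀ (w : Word) → w ∈ Sh n v → RISE w ≐ RISE• (Φ w))
theorem1p1 m v der n m≤n = Φ-bijection good , rises
  where
  good : Good v
  good = derangement⇒good der
  good-Pos : ∀ w → w ∈ Sh n v → Good (Pos w)
  good-Pos w (_ , _ , refl) = good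
  rises : ∀ w → w ∈ Sh n v → RISE w ≐ RISE• (Φ w)
  rises w w∈@(len , _) = (λ r → from• (subst (λ bs → Marked bs _) (marks-Φ good w w∈) (to r))) ,
                         (λ r → from (subst (λ bs → Marked bs _) (sym (marks-Φ good w w∈)) (to• r)))
    where
    -- Level `n` puts every 0 under the rule of RISE.
    #zero≤n : #zero w ≤ n
    #zero≤n = subst (#zero w ≤_) (trans (sym (length-#pos-#zero w)) len) (m≤n+m (#zero w) (#pos w))
    open Σ (RISE-marks n w (good-Pos w w∈) #zero≤n) renaming (proj₁ to to; proj₂ to from)
    open Σ (RISE•-marks (Φ w) (good-Pos (Φ w) (Φ-closed good w w∈))) renaming (proj₁ to to•; proj₂ to from•)
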